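{- Let $A_2$ be the hexagonal lattice in $\mathbb{R}^2\cong\mathbb{C}$, i.e. the lattice $\mathbb{Z}+\mathbb{Z}\frac{1+\sqrt{ -3}}{2}$ (the ring of integers of $\mathbb{Q}(\sqrt{ -3})$). For every $m>0$ such that the shell $(A_2)_m=\{x\in A_2 : (x,x)=m\}$ is nonempty, the shell $(A_2)_m$ is not a spherical $6$-design.
   Context: $(x,y)$ denotes the standard Euclidean inner product on $\mathbb{R}^2\cong\mathbb{C}$, so $(x,x)=|x|^2$. A finite nonempty set $X\subset S^{n-1}$ is a spherical $t$-design if $\frac{1}{|X|}\sum_{x\in X}f(x)=\frac{1}{|S^{n-1}|}\int_{S^{n-1}}f\,d\sigma$ for all polynomials $f$ of degree at most $t$; a finite nonempty subset $X$ of the sphere of radius $r$ is a spherical $t$-design if $\frac{1}{r}X$ is one. (For $n=2$, a finite set $\{\xi_1,\dots,\xi_N\}$ on the unit circle in $\mathbb{C}$ is a spherical $t$-design iff $\sum_i\xi_i^k=0$ for $k=1,\dots,t$.) -}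

module Defs where

open import Data.Bool using (if_then_else_; true; false)
open import Data.Integer as ℤ using (ℤ; +_; -[1+_])
open import Data.List using (List; []; _∷_; foldr; map; length)
open import Data.List.Relation.Unary.All using (All)
open import Data.List.Relation.Unary.AllPairs using (AllPairs)
open import Data.List.Relation.Unary.Any using (Any)
open import Data.Nat as ℕ using (ℕ; zero; suc)
import Data.Nat.Properties as ℕₚ
import Data.Integer.Properties as ℤₚ
import Data.Integer.Solver as ℤ-Solver
import Data.Rational.Unnormalised.Base as ℚᵘ
import Data.Rational.Unnormalised.Properties as ℚᵘₚ
open import Data.Product using (_×_; _,_; proj₁; proj₂; ∃-syntax)
open import Data.Rational as ℚ using (ℚ; 0ℚ; 1ℚ; ½; ∣_∣; 1/_; NonZero; positive; nonNegative)
open import Data.Rational.Properties as ℚₚ using (module ≤-Reasoning)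
open import Data.Rational.Solver using (module +-*-Solver)
open import Data.Sum using (inj₁; inj₂)
open import Relation.Binary.PropositionalEquality using (_≡_; _≢_; refl; sym; trans; cong; cong₂; subst; subst₂)
open import Relation.Nullary using (¬_; does)

open +-*-Solver using (solve; con; _:+_; _:*_; _:-_; :-_; _:=_)

2ℚ : ℚ
2ℚ = + 2 ℚ./ 1

½^_ : ℕ → ℚ
½^ zero  = 1ℚ
½^ suc n = ½ ℚ.* ½^ n

∣_-_∣ : ℚ → ℚ → ℚ
∣ p - q ∣ = ∣ p ℚ.- q ∣

triangle : ∀ p q r → ∣ p - r ∣ ℚ.≤ ∣ p - q ∣ ℚ.+ ∣ q - r ∣
triangle p q r = subst (λ z → ∣ z ∣ ℚ.≤ ∣ p - q ∣ ℚ.+ ∣ q - r ∣)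
  (solve 3 (λ p q r → (p :- q) :+ (q :- r) := p :- r) refl p q r)
  (ℚₚ.∣p+q∣≤∣p∣+∣q∣ (p ℚ.- q) (q ℚ.- r))

∣-∣-sym : ∀ p q → ∣ p - q ∣ ≡ ∣ q - p ∣
∣-∣-sym p q = trans (cong ∣_∣ (solve 2 (λ p q → p :- q := :- (q :- p)) refl p q)) (ℚₚ.∣-p∣≡∣p∣ (q ℚ.- p))

*-mono-≤ : ∀ {p q r s} → 0ℚ ℚ.≤ r → 0ℚ ℚ.≤ q → p ℚ.≤ q → r ℚ.≤ s → p ℚ.* r ℚ.≤ q ℚ.* s
*-mono-≤ {p} {q} {r} {s} 0≤r 0≤q p≤q r≤s =
  ℚₚ.≤-trans (ℚₚ.*-monoʳ-≤-nonNeg r {{nonNegative 0≤r}} p≤q)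
             (ℚₚ.*-monoˡ-≤-nonNeg q {{nonNegative 0≤q}} r≤s)

0≤+ : ∀ {p q} → 0ℚ ℚ.≤ p → 0ℚ ℚ.≤ q → 0ℚ ℚ.≤ p ℚ.+ q
0≤+ {p} {q} a b = ℚₚ.+-mono-≤ a b

0≤* : ∀ {p q} → 0ℚ ℚ.≤ p → 0ℚ ℚ.≤ q → 0ℚ ℚ.≤ p ℚ.* q
0≤* {p} {q} a b = subst (ℚ._≤ p ℚ.* q) (ℚₚ.*-zeroˡ 0ℚ) (*-mono-≤ ℚₚ.≤-refl a a b)

0≤1 : 0ℚ ℚ.≤ 1ℚ
0≤1 = ℚ.*≤* (ℤ.+≤+ ℕ.z≤n)

0≤½ : 0ℚ ℚ.≤ ½
0≤½ = ℚ.*≤* (ℤ.+≤+ ℕ.z≤n)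

0≤2 : 0ℚ ℚ.≤ 2ℚ
0≤2 = ℚ.*≤* (ℤ.+≤+ ℕ.z≤n)

0<½ : 0ℚ ℚ.< ½
0<½ = ℚₚ.positive⁻¹ ½

0<* : ∀ {p q} → 0ℚ ℚ.< p → 0ℚ ℚ.< q → 0ℚ ℚ.< p ℚ.* q
0<* {p} {q} a b = ℚₚ.positive⁻¹ (p ℚ.* q) {{ℚₚ.pos*pos⇒pos p {{positive a}} q {{positive b}}}}

0≤½^ : ∀ n → 0ℚ ℚ.≤ ½^ n
0≤½^ zero    = 0≤1
0≤½^ (suc n) = 0≤* 0≤½ (0≤½^ n)

fromℕ : ℕ → ℚ
fromℕ zero    = 0ℚ
fromℕ (suc n) = 1ℚ ℚ.+ fromℕ n

0≤fromℕ : ∀ n → 0ℚ ℚ.≤ fromℕ n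
0≤fromℕ zero    = ℚₚ.≤-refl
0≤fromℕ (suc n) = 0≤+ 0≤1 (0≤fromℕ n)

½^≤1 : ∀ n → ½^ n ℚ.≤ 1ℚ
½^≤1 zero    = ℚₚ.≤-refl
½^≤1 (suc n) = ℚₚ.≤-trans (ℚₚ.*-monoˡ-≤-nonNeg ½ (½^≤1 n)) (ℚ.*≤* (ℤ.+≤+ (ℕ.s≤s ℕ.z≤n)))

n½^n≤1 : ∀ n → fromℕ n ℚ.* ½^ n ℚ.≤ 1ℚ
n½^n≤1 zero    = subst (ℚ._≤ 1ℚ) (sym (ℚₚ.*-zeroˡ 1ℚ)) 0≤1
n½^n≤1 (suc n) = begin
  (1ℚ ℚ.+ fromℕ n) ℚ.* (½ ℚ.* ½^ n)
    ≡⟨ solve 2 (λ a h → (con 1ℚ :+ a) :* (con ½ :* h) := con ½ :* h :+ con ½ :* (a :* h)) refl (fromℕ n) (½^ n) ⟩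
  ½ ℚ.* ½^ n ℚ.+ ½ ℚ.* (fromℕ n ℚ.* ½^ n)
    ≤⟨ ℚₚ.+-mono-≤ (ℚₚ.*-monoˡ-≤-nonNeg ½ (½^≤1 n)) (ℚₚ.*-monoˡ-≤-nonNeg ½ (n½^n≤1 n)) ⟩
  1ℚ ∎
  where open ≤-Reasoning

fromℕ≡ : ∀ n → fromℕ n ≡ + n ℚ./ 1
fromℕ≡ zero    = refl
fromℕ≡ (suc n) = trans (cong (1ℚ ℚ.+_) (fromℕ≡ n)) (ℚₚ.toℚᵘ-injective
  (ℚᵘₚ.≃-trans (ℚₚ.toℚᵘ-homo-+ 1ℚ (+ n ℚ./ 1))
  (ℚᵘₚ.≃-trans (ℚᵘₚ.+-congʳ (ℚ.toℚᵘ 1ℚ) (ℚₚ.toℚᵘ-fromℚᵘ (ℚᵘ.mkℚᵘ (+ n) 0)))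
  (ℚᵘₚ.≃-trans {j = ℚᵘ.mkℚᵘ (+ suc n) 0} (ℚᵘ.*≡* (ℤ-eq (+ n)))
               (ℚᵘₚ.≃-sym (ℚₚ.toℚᵘ-fromℚᵘ (ℚᵘ.mkℚᵘ (+ suc n) 0)))))))
  where
    ℤ-eq : ∀ z → (+ 1 ℤ.* + 1 ℤ.+ z ℤ.* + 1) ℤ.* + 1 ≡ (+ 1 ℤ.+ z) ℤ.* (+ 1 ℤ.* + 1)
    ℤ-eq = S.solve 1 (λ z → (S.con (+ 1) S.:* S.con (+ 1) S.:+ z S.:* S.con (+ 1)) S.:* S.con (+ 1)
                      S.:= (S.con (+ 1) S.:+ z) S.:* (S.con (+ 1) S.:* S.con (+ 1))) refl
      where module S = ℤ-Solver.+-*-Solver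

≤-fromℕ : ∀ p → ∃[ n ] p ℚ.≤ fromℕ n
≤-fromℕ p@(ℚ.mkℚ z d _) = ℤ.∣ z ∣ , subst (p ℚ.≤_) (sym (fromℕ≡ ℤ.∣ z ∣))
  (ℚₚ.toℚᵘ-cancel-≤ (ℚᵘₚ.≤-respʳ-≃ (ℚᵘₚ.≃-sym (ℚₚ.toℚᵘ-fromℚᵘ (ℚᵘ.mkℚᵘ (+ ℤ.∣ z ∣) 0)))
    (ℚᵘ.*≤* (bound z))))
  where
    bound : ∀ z → z ℤ.* + 1 ℤ.≤ + ℤ.∣ z ∣ ℤ.* + suc d
    bound (+ n)    = subst (ℤ._≤ + n ℤ.* + suc d) (sym (ℤₚ.*-identityʳ (+ n)))
                       (subst (+ n ℤ.≤_) (ℤₚ.pos-* n (suc d)) (ℤ.+≤+ (ℕₚ.m≤m*n n (suc d))))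
    bound -[1+ n ] = ℤₚ.≤-trans ℤ.-≤+ (ℤ.+≤+ ℕ.z≤n)

archimedean : ∀ K {ε} → 0ℚ ℚ.< ε → ∃[ N ] K ℚ.* ½^ N ℚ.≤ ε
archimedean K {ε} 0<ε with ≤-fromℕ (K ℚ.* (1/ ε) {{ℚ.>-nonZero 0<ε}})
... | N , K/ε≤N = N , (begin
    K ℚ.* ½^ N
      ≡⟨ cong (ℚ._* ½^ N) (trans (sym (ℚₚ.*-identityʳ K))
           (trans (cong (K ℚ.*_) (sym (ℚₚ.*-inverseˡ ε))) (sym (ℚₚ.*-assoc K (1/ ε) ε)))) ⟩
    K ℚ.* 1/ ε ℚ.* ε ℚ.* ½^ N
      ≤⟨ *-mono-≤ (0≤½^ N) (0≤* (0≤fromℕ N) (ℚₚ.<⇒≤ 0<ε))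
           (ℚₚ.*-monoʳ-≤-nonNeg ε {{nonNegative (ℚₚ.<⇒≤ 0<ε)}} K/ε≤N) ℚₚ.≤-refl ⟩
    fromℕ N ℚ.* ε ℚ.* ½^ N
      ≡⟨ solve 3 (λ a b c → a :* b :* c := b :* (a :* c)) refl (fromℕ N) ε (½^ N) ⟩
    ε ℚ.* (fromℕ N ℚ.* ½^ N)
      ≤⟨ ℚₚ.*-monoˡ-≤-nonNeg ε {{nonNegative (ℚₚ.<⇒≤ 0<ε)}} (n½^n≤1 N) ⟩
    ε ℚ.* 1ℚ
      ≡⟨ ℚₚ.*-identityʳ ε ⟩
    ε ∎)
  where
    open ≤-Reasoning
    instance
      ε≢0 : NonZero ε
      ε≢0 = ℚ.>-nonZero 0<ε

Cauchy : (ℕ → ℚ) → Set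
Cauchy x = ∀ ε → 0ℚ ℚ.< ε → ∃[ N ] ∀ m n → N ℕ.≤ m → N ℕ.≤ n → ∣ x m - x n ∣ ℚ.≤ ε

-- Two Cauchy sequences denote the same real number when they are related by
-- _≈_ below.
record ℝ : Set where
  no-eta-equality
  field
    seq    : ℕ → ℚ
    cauchy : Cauchy seq

open ℝ public

infix 4 _≈_ _<_

record _≈_ (x y : ℝ) : Set where
  constructor mk≈
  field
    null : ∀ ε → 0ℚ ℚ.< ε → ∃[ N ] ∀ n → N ℕ.≤ n → ∣ seq x n - seq y n ∣ ℚ.≤ ε

record _<_ (x y : ℝ) : Set where
  constructor mk<
  field
    gap      : ℚ
    0<gap    : 0ℚ ℚ.< gap
    eventual : ∃[ N ] ∀ n → N ℕ.≤ n → seq x n ℚ.+ gap ℚ.≤ seq y n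

geometric⇒Cauchy : ∀ x K → 0ℚ ℚ.≤ K → (∀ n → ∣ x (suc n) - x n ∣ ℚ.≤ K ℚ.* ½^ n) → Cauchy x
geometric⇒Cauchy x K 0≤K step ε 0<ε = N , λ m n N≤m N≤n → begin
    ∣ x m - x n ∣
      ≤⟨ triangle (x m) (x N) (x n) ⟩
    ∣ x m - x N ∣ ℚ.+ ∣ x N - x n ∣
      ≡⟨ cong (∣ x m - x N ∣ ℚ.+_) (∣-∣-sym (x N) (x n)) ⟩
    ∣ x m - x N ∣ ℚ.+ ∣ x n - x N ∣
      ≤⟨ ℚₚ.+-mono-≤ (tail m N≤m) (tail n N≤n) ⟩
    2K ℚ.* ½^ N ℚ.+ 2K ℚ.* ½^ N
      ≡⟨ solve 2 (λ k h → k :* h :+ k :* h := (k :+ k) :* h) refl 2K (½^ N) ⟩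
    (2K ℚ.+ 2K) ℚ.* ½^ N
      ≤⟨ proj₂ (archimedean (2K ℚ.+ 2K) 0<ε) ⟩
    ε ∎
  where
    open ≤-Reasoning
    2K = K ℚ.+ K
    N = proj₁ (archimedean (2K ℚ.+ 2K) 0<ε)

    telescope : ∀ d n → ∣ x (d ℕ.+ n) - x n ∣ ℚ.+ 2K ℚ.* ½^ (d ℕ.+ n) ℚ.≤ 2K ℚ.* ½^ n
    telescope zero n = ℚₚ.≤-reflexive (trans (cong (λ z → ∣ z ∣ ℚ.+ 2K ℚ.* ½^ n) (ℚₚ.+-inverseʳ (x n)))
                                            (ℚₚ.+-identityˡ (2K ℚ.* ½^ n)))
    telescope (suc d) n = begin
      ∣ x (suc d ℕ.+ n) - x n ∣ ℚ.+ 2K ℚ.* ½^ (suc d ℕ.+ n)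
        ≤⟨ ℚₚ.+-monoˡ-≤ (2K ℚ.* ½^ (suc d ℕ.+ n)) (triangle (x (suc d ℕ.+ n)) (x (d ℕ.+ n)) (x n)) ⟩
      ∣ x (suc d ℕ.+ n) - x (d ℕ.+ n) ∣ ℚ.+ ∣ x (d ℕ.+ n) - x n ∣ ℚ.+ 2K ℚ.* ½^ (suc d ℕ.+ n)
        ≤⟨ ℚₚ.+-monoˡ-≤ (2K ℚ.* ½^ (suc d ℕ.+ n)) (ℚₚ.+-monoˡ-≤ ∣ x (d ℕ.+ n) - x n ∣ (step (d ℕ.+ n))) ⟩
      K ℚ.* ½^ (d ℕ.+ n) ℚ.+ ∣ x (d ℕ.+ n) - x n ∣ ℚ.+ 2K ℚ.* ½^ (suc d ℕ.+ n)
        ≡⟨ solve 3 (λ k h a → k :* h :+ a :+ (k :+ k) :* (con ½ :* h) := a :+ (k :+ k) :* h) refl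
             K (½^ (d ℕ.+ n)) ∣ x (d ℕ.+ n) - x n ∣ ⟩
      ∣ x (d ℕ.+ n) - x n ∣ ℚ.+ 2K ℚ.* ½^ (d ℕ.+ n)
        ≤⟨ telescope d n ⟩
      2K ℚ.* ½^ n ∎

    tail : ∀ m → N ℕ.≤ m → ∣ x m - x N ∣ ℚ.≤ 2K ℚ.* ½^ N
    tail m N≤m = subst (λ k → ∣ x k - x N ∣ ℚ.≤ 2K ℚ.* ½^ N) (ℕₚ.m∸n+n≡m N≤m) (begin
      ∣ x (m ℕ.∸ N ℕ.+ N) - x N ∣
        ≡⟨ sym (ℚₚ.+-identityʳ ∣ x (m ℕ.∸ N ℕ.+ N) - x N ∣) ⟩
      ∣ x (m ℕ.∸ N ℕ.+ N) - x N ∣ ℚ.+ 0ℚ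
        ≤⟨ ℚₚ.+-monoʳ-≤ ∣ x (m ℕ.∸ N ℕ.+ N) - x N ∣ (0≤* (0≤+ 0≤K 0≤K) (0≤½^ (m ℕ.∸ N ℕ.+ N))) ⟩
      ∣ x (m ℕ.∸ N ℕ.+ N) - x N ∣ ℚ.+ 2K ℚ.* ½^ (m ℕ.∸ N ℕ.+ N)
        ≤⟨ telescope (m ℕ.∸ N) N ⟩
      2K ℚ.* ½^ N ∎)

fromℚ : ℚ → ℝ
seq    (fromℚ q) _     = q
cauchy (fromℚ q) ε 0<ε = 0 , λ _ _ _ _ →
  subst (λ z → ∣ z ∣ ℚ.≤ ε) (sym (ℚₚ.+-inverseʳ q)) (ℚₚ.<⇒≤ 0<ε)

fromℤ : ℤ → ℝ
fromℤ z = fromℚ (z ℚ./ 1)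

0ℝ 1ℝ : ℝ
0ℝ = fromℚ 0ℚ
1ℝ = fromℚ 1ℚ

½+½ : ∀ ε → ½ ℚ.* ε ℚ.+ ½ ℚ.* ε ≡ ε
½+½ = solve 1 (λ ε → con ½ :* ε :+ con ½ :* ε := ε) refl

infixl 6 _+_
infixl 7 _*_
infixr 8 _^_

+-cauchy : ∀ {x y} → Cauchy x → Cauchy y → Cauchy (λ n → x n ℚ.+ y n)
+-cauchy {x} {y} cx cy ε 0<ε =
  let M , px = cx (½ ℚ.* ε) (0<* 0<½ 0<ε)
      N , py = cy (½ ℚ.* ε) (0<* 0<½ 0<ε)
  in M ℕ.⊔ N , λ m n ≤m ≤n → begin
    ∣ x m ℚ.+ y m - (x n ℚ.+ y n) ∣
      ≡⟨ cong ∣_∣ (solve 4 (λ a b c d → (a :+ b) :- (c :+ d) := (a :- c) :+ (b :- d)) refl (x m) (y m) (x n) (y n)) ⟩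
    ∣ (x m ℚ.- x n) ℚ.+ (y m ℚ.- y n) ∣
      ≤⟨ ℚₚ.∣p+q∣≤∣p∣+∣q∣ (x m ℚ.- x n) (y m ℚ.- y n) ⟩
    ∣ x m - x n ∣ ℚ.+ ∣ y m - y n ∣
      ≤⟨ ℚₚ.+-mono-≤
           (px m n (ℕₚ.m⊔n≤o⇒m≤o M N ≤m) (ℕₚ.m⊔n≤o⇒m≤o M N ≤n))
           (py m n (ℕₚ.m⊔n≤o⇒n≤o M N ≤m) (ℕₚ.m⊔n≤o⇒n≤o M N ≤n)) ⟩
    ½ ℚ.* ε ℚ.+ ½ ℚ.* ε
      ≡⟨ ½+½ ε ⟩
    ε ∎
  where open ≤-Reasoning

_+_ : ℝ → ℝ → ℝ
seq    (x + y) n = seq x n ℚ.+ seq y n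
cauchy (x + y)   = +-cauchy {seq x} {seq y} (cauchy x) (cauchy y)

eventuallyBounded : ∀ {x} → Cauchy x → ∃[ B ] 0ℚ ℚ.< B × (∃[ N ] ∀ n → N ℕ.≤ n → ∣ x n ∣ ℚ.≤ B)
eventuallyBounded {x} cx with cx 1ℚ (ℚₚ.positive⁻¹ 1ℚ)
... | N , p = 1ℚ ℚ.+ ∣ x N ∣ , ℚₚ.+-mono-<-≤ (ℚₚ.positive⁻¹ 1ℚ) (ℚₚ.0≤∣p∣ (x N)) , N , λ n N≤n → begin
    ∣ x n ∣
      ≡⟨ cong ∣_∣ (solve 2 (λ a b → a := (a :- b) :+ b) refl (x n) (x N)) ⟩
    ∣ (x n ℚ.- x N) ℚ.+ x N ∣
      ≤⟨ ℚₚ.∣p+q∣≤∣p∣+∣q∣ (x n ℚ.- x N) (x N) ⟩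
    ∣ x n - x N ∣ ℚ.+ ∣ x N ∣
      ≤⟨ ℚₚ.+-monoˡ-≤ ∣ x N ∣ (p n N N≤n ℕₚ.≤-refl) ⟩
    1ℚ ℚ.+ ∣ x N ∣ ∎
  where open ≤-Reasoning

∣product-product∣ : ∀ a b c d → ∣ a ℚ.* b - c ℚ.* d ∣ ℚ.≤ ∣ a ∣ ℚ.* ∣ b - d ∣ ℚ.+ ∣ d ∣ ℚ.* ∣ a - c ∣
∣product-product∣ a b c d = begin
    ∣ a ℚ.* b - c ℚ.* d ∣
      ≡⟨ cong ∣_∣ (solve 4 (λ a b c d → a :* b :- c :* d := a :* (b :- d) :+ d :* (a :- c)) refl a b c d) ⟩
    ∣ a ℚ.* (b ℚ.- d) ℚ.+ d ℚ.* (a ℚ.- c) ∣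
      ≤⟨ ℚₚ.∣p+q∣≤∣p∣+∣q∣ (a ℚ.* (b ℚ.- d)) (d ℚ.* (a ℚ.- c)) ⟩
    ∣ a ℚ.* (b ℚ.- d) ∣ ℚ.+ ∣ d ℚ.* (a ℚ.- c) ∣
      ≡⟨ cong₂ ℚ._+_ (ℚₚ.∣p*q∣≡∣p∣*∣q∣ a (b ℚ.- d)) (ℚₚ.∣p*q∣≡∣p∣*∣q∣ d (a ℚ.- c)) ⟩
    ∣ a ∣ ℚ.* ∣ b - d ∣ ℚ.+ ∣ d ∣ ℚ.* ∣ a - c ∣ ∎
  where open ≤-Reasoning

divide : ∀ {A ε} → 0ℚ ℚ.< A → 0ℚ ℚ.< ε → ∃[ δ ] 0ℚ ℚ.< δ × A ℚ.* δ ≡ ½ ℚ.* ε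
divide {A} {ε} 0<A 0<ε = A⁻¹ ℚ.* (½ ℚ.* ε) , 0<* 0<A⁻¹ (0<* 0<½ 0<ε) ,
  trans (sym (ℚₚ.*-assoc A A⁻¹ (½ ℚ.* ε)))
    (trans (cong (ℚ._* (½ ℚ.* ε)) (ℚₚ.*-inverseʳ A {{ℚ.>-nonZero 0<A}})) (ℚₚ.*-identityˡ (½ ℚ.* ε)))
  where
    A⁻¹ = (1/ A) {{ℚ.>-nonZero 0<A}}
    0<A⁻¹ : 0ℚ ℚ.< A⁻¹
    0<A⁻¹ = ℚₚ.positive⁻¹ A⁻¹ {{ℚₚ.1/pos⇒pos A {{positive 0<A}}}}

∣product-product∣≤ : ∀ {a b c d A B δ η ε} → 0ℚ ℚ.≤ A → 0ℚ ℚ.≤ B → A ℚ.* δ ≡ ½ ℚ.* ε → B ℚ.* η ≡ ½ ℚ.* ε →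
  ∣ a ∣ ℚ.≤ A → ∣ d ∣ ℚ.≤ B → ∣ b - d ∣ ℚ.≤ δ → ∣ a - c ∣ ℚ.≤ η → ∣ a ℚ.* b - c ℚ.* d ∣ ℚ.≤ ε
∣product-product∣≤ {a} {b} {c} {d} {A} {B} {δ} {η} {ε} 0≤A 0≤B Aδ Bη a≤A d≤B b-d≤δ a-c≤η = begin
    ∣ a ℚ.* b - c ℚ.* d ∣
      ≤⟨ ∣product-product∣ a b c d ⟩
    ∣ a ∣ ℚ.* ∣ b - d ∣ ℚ.+ ∣ d ∣ ℚ.* ∣ a - c ∣
      ≤⟨ ℚₚ.+-mono-≤ (*-mono-≤ (ℚₚ.0≤∣p∣ (b ℚ.- d)) 0≤A a≤A b-d≤δ) (*-mono-≤ (ℚₚ.0≤∣p∣ (a ℚ.- c)) 0≤B d≤B a-c≤η) ⟩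
    A ℚ.* δ ℚ.+ B ℚ.* η
      ≡⟨ cong₂ ℚ._+_ Aδ Bη ⟩
    ½ ℚ.* ε ℚ.+ ½ ℚ.* ε
      ≡⟨ ½+½ ε ⟩
    ε ∎
  where open ≤-Reasoning

*-cauchy : ∀ {x y} → Cauchy x → Cauchy y → Cauchy (λ n → x n ℚ.* y n)
*-cauchy {x} {y} cx cy ε 0<ε =
  let A , 0<A , L , ∣x∣≤A = eventuallyBounded {x} cx
      B , 0<B , M , ∣y∣≤B = eventuallyBounded {y} cy
      δ , 0<δ , Aδ = divide {A} {ε} 0<A 0<ε
      η , 0<η , Bη = divide {B} {ε} 0<B 0<ε
      Y , y-close = cy δ 0<δ
      X , x-close = cx η 0<η
      L≤ = λ {n} (p : (L ℕ.⊔ M) ℕ.⊔ (X ℕ.⊔ Y) ℕ.≤ n) → ℕₚ.m⊔n≤o⇒m≤o L M (ℕₚ.m⊔n≤o⇒m≤o (L ℕ.⊔ M) (X ℕ.⊔ Y) p)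
      M≤ = λ {n} (p : (L ℕ.⊔ M) ℕ.⊔ (X ℕ.⊔ Y) ℕ.≤ n) → ℕₚ.m⊔n≤o⇒n≤o L M (ℕₚ.m⊔n≤o⇒m≤o (L ℕ.⊔ M) (X ℕ.⊔ Y) p)
      X≤ = λ {n} (p : (L ℕ.⊔ M) ℕ.⊔ (X ℕ.⊔ Y) ℕ.≤ n) → ℕₚ.m⊔n≤o⇒m≤o X Y (ℕₚ.m⊔n≤o⇒n≤o (L ℕ.⊔ M) (X ℕ.⊔ Y) p)
      Y≤ = λ {n} (p : (L ℕ.⊔ M) ℕ.⊔ (X ℕ.⊔ Y) ℕ.≤ n) → ℕₚ.m⊔n≤o⇒n≤o X Y (ℕₚ.m⊔n≤o⇒n≤o (L ℕ.⊔ M) (X ℕ.⊔ Y) p)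
  in (L ℕ.⊔ M) ℕ.⊔ (X ℕ.⊔ Y) , λ m n ≤m ≤n →
    ∣product-product∣≤ {x m} {y m} {x n} {y n} {A} {B} {δ} {η} {ε} (ℚₚ.<⇒≤ 0<A) (ℚₚ.<⇒≤ 0<B) Aδ Bη
      (∣x∣≤A m (L≤ ≤m)) (∣y∣≤B n (M≤ ≤n)) (y-close m n (Y≤ ≤m) (Y≤ ≤n)) (x-close m n (X≤ ≤m) (X≤ ≤n))

_*_ : ℝ → ℝ → ℝ
seq    (x * y) n = seq x n ℚ.* seq y n
cauchy (x * y)   = *-cauchy {seq x} {seq y} (cauchy x) (cauchy y)

_^_ : ℝ → ℕ → ℝ
x ^ zero  = 1ℝ
x ^ suc n = x * x ^ n

sum : List ℝ → ℝ
sum = foldr _+_ 0ℝ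

-- √3 by bisection: √3-seq n is the largest multiple of ½^ n whose square
-- does not exceed 3.

3ℚ : ℚ
3ℚ = + 3 ℚ./ 1

√3-seq : ℕ → ℚ
√3-seq zero    = 1ℚ
√3-seq (suc n) =
  if does (next ℚ.* next ℚₚ.≤? 3ℚ) then next else √3-seq n
  where next = √3-seq n ℚ.+ ½^ suc n

√3-step : ∀ n → ∣ √3-seq (suc n) - √3-seq n ∣ ℚ.≤ ½^ n
√3-step n with does ((√3-seq n ℚ.+ ½^ suc n) ℚ.* (√3-seq n ℚ.+ ½^ suc n) ℚₚ.≤? 3ℚ)
... | true  = begin
  ∣ √3-seq n ℚ.+ ½^ suc n - √3-seq n ∣
    ≡⟨ cong ∣_∣ (solve 2 (λ a h → (a :+ h) :- a := h) refl (√3-seq n) (½^ suc n)) ⟩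
  ∣ ½^ suc n ∣
    ≡⟨ ℚₚ.0≤p⇒∣p∣≡p (0≤½^ (suc n)) ⟩
  ½ ℚ.* ½^ n
    ≤⟨ ℚₚ.*-monoʳ-≤-nonNeg (½^ n) {{nonNegative (0≤½^ n)}} (ℚ.*≤* {½} {1ℚ} (ℤ.+≤+ (ℕ.s≤s ℕ.z≤n))) ⟩
  1ℚ ℚ.* ½^ n
    ≡⟨ ℚₚ.*-identityˡ (½^ n) ⟩
  ½^ n ∎
  where open ≤-Reasoning
... | false = subst (λ z → ∣ z ∣ ℚ.≤ ½^ n) (sym (ℚₚ.+-inverseʳ (√3-seq n))) (0≤½^ n)

√3 : ℝ
seq    √3 = √3-seq
cauchy √3 = geometric⇒Cauchy √3-seq 1ℚ 0≤1 λ n →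
  subst (∣ √3-seq (suc n) - √3-seq n ∣ ℚ.≤_) (sym (ℚₚ.*-identityˡ (½^ n))) (√3-step n)

record BoundedLipschitz (g : ℚ → ℚ) : Set where
  constructor mkBL
  field
    bound         : ℚ
    0≤bound       : 0ℚ ℚ.≤ bound
    bounded       : ∀ s → ∣ g s ∣ ℚ.≤ bound
    constant      : ℚ
    0≤constant    : 0ℚ ℚ.≤ constant
    lipschitz     : ∀ s t → ∣ g s - g t ∣ ℚ.≤ constant ℚ.* ∣ s - t ∣

-- The right-endpoint Riemann sum of g over [a , a + h] for the partition
-- into 2ⁿ subintervals of equal length.

riemannSum : (ℚ → ℚ) → ℚ → ℚ → ℕ → ℚ
riemannSum g a h zero    = h ℚ.* g (a ℚ.+ h)
riemannSum g a h (suc n) = riemannSum g a (½ ℚ.* h) n ℚ.+ riemannSum g (a ℚ.+ ½ ℚ.* h) (½ ℚ.* h) n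

riemannSum-step : ∀ {g} (bl : BoundedLipschitz g) → let open BoundedLipschitz bl in ∀ n a h → 0ℚ ℚ.≤ h →
  ∣ riemannSum g a h (suc n) - riemannSum g a h n ∣ ℚ.≤ constant ℚ.* (h ℚ.* h) ℚ.* ½^ n
riemannSum-step {g} (mkBL _ _ _ K 0≤K lip) zero a h 0≤h = begin
    ∣ k ℚ.* g (a ℚ.+ k) ℚ.+ k ℚ.* g (a ℚ.+ k ℚ.+ k) - h ℚ.* g (a ℚ.+ h) ∣
      ≡⟨ cong (λ z → ∣ k ℚ.* g (a ℚ.+ k) ℚ.+ k ℚ.* g z - h ℚ.* g (a ℚ.+ h) ∣)
           (solve 2 (λ a h → a :+ con ½ :* h :+ con ½ :* h := a :+ h) refl a h) ⟩
    ∣ k ℚ.* g (a ℚ.+ k) ℚ.+ k ℚ.* g (a ℚ.+ h) - h ℚ.* g (a ℚ.+ h) ∣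
      ≡⟨ cong ∣_∣ (solve 3 (λ h u v → con ½ :* h :* u :+ con ½ :* h :* v :- h :* v := con ½ :* h :* (u :- v)) refl
           h (g (a ℚ.+ k)) (g (a ℚ.+ h))) ⟩
    ∣ k ℚ.* (g (a ℚ.+ k) ℚ.- g (a ℚ.+ h)) ∣
      ≡⟨ ℚₚ.∣p*q∣≡∣p∣*∣q∣ k (g (a ℚ.+ k) ℚ.- g (a ℚ.+ h)) ⟩
    ∣ k ∣ ℚ.* ∣ g (a ℚ.+ k) - g (a ℚ.+ h) ∣
      ≡⟨ cong (ℚ._* ∣ g (a ℚ.+ k) - g (a ℚ.+ h) ∣) (ℚₚ.0≤p⇒∣p∣≡p 0≤k) ⟩
    k ℚ.* ∣ g (a ℚ.+ k) - g (a ℚ.+ h) ∣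
      ≤⟨ *-mono-≤ (ℚₚ.0≤∣p∣ (g (a ℚ.+ k) ℚ.- g (a ℚ.+ h))) 0≤h k≤h (lip (a ℚ.+ k) (a ℚ.+ h)) ⟩
    h ℚ.* (K ℚ.* ∣ a ℚ.+ k - (a ℚ.+ h) ∣)
      ≡⟨ cong (λ z → h ℚ.* (K ℚ.* z)) (trans (cong ∣_∣ (solve 2 (λ a h → a :+ con ½ :* h :- (a :+ h) := :- (con ½ :* h)) refl a h))
           (trans (ℚₚ.∣-p∣≡∣p∣ k) (ℚₚ.0≤p⇒∣p∣≡p 0≤k))) ⟩
    h ℚ.* (K ℚ.* k)
      ≤⟨ ℚₚ.*-monoˡ-≤-nonNeg h {{nonNegative 0≤h}} (ℚₚ.*-monoˡ-≤-nonNeg K {{nonNegative 0≤K}} k≤h) ⟩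
    h ℚ.* (K ℚ.* h)
      ≡⟨ solve 2 (λ h k → h :* (k :* h) := k :* (h :* h) :* con 1ℚ) refl h K ⟩
    K ℚ.* (h ℚ.* h) ℚ.* 1ℚ ∎
  where
    open ≤-Reasoning
    k = ½ ℚ.* h
    0≤k = 0≤* 0≤½ 0≤h
    k≤h : k ℚ.≤ h
    k≤h = subst₂ ℚ._≤_ (ℚₚ.+-identityʳ k) (½+½ h) (ℚₚ.+-monoʳ-≤ k 0≤k)
riemannSum-step {g} bl@(mkBL _ _ _ K _ _) (suc n) a h 0≤h = begin
    ∣ (p′ ℚ.+ q′) - (p ℚ.+ q) ∣
      ≡⟨ cong ∣_∣ (solve 4 (λ a b c d → (a :+ b) :- (c :+ d) := (a :- c) :+ (b :- d)) refl p′ q′ p q) ⟩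
    ∣ (p′ ℚ.- p) ℚ.+ (q′ ℚ.- q) ∣
      ≤⟨ ℚₚ.∣p+q∣≤∣p∣+∣q∣ (p′ ℚ.- p) (q′ ℚ.- q) ⟩
    ∣ p′ - p ∣ ℚ.+ ∣ q′ - q ∣
      ≤⟨ ℚₚ.+-mono-≤ (riemannSum-step bl n a k 0≤k) (riemannSum-step bl n (a ℚ.+ k) k 0≤k) ⟩
    K ℚ.* (k ℚ.* k) ℚ.* ½^ n ℚ.+ K ℚ.* (k ℚ.* k) ℚ.* ½^ n
      ≡⟨ solve 3 (λ K h e → K :* (con ½ :* h :* (con ½ :* h)) :* e :+ K :* (con ½ :* h :* (con ½ :* h)) :* e
           := K :* (h :* h) :* (con ½ :* e)) refl K h (½^ n) ⟩
    K ℚ.* (h ℚ.* h) ℚ.* ½^ suc n ∎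
  where
    open ≤-Reasoning
    k = ½ ℚ.* h
    0≤k = 0≤* 0≤½ 0≤h
    p  = riemannSum g a k n
    q  = riemannSum g (a ℚ.+ k) k n
    p′ = riemannSum g a k (suc n)
    q′ = riemannSum g (a ℚ.+ k) k (suc n)

riemannSum-cauchy : ∀ {g} → BoundedLipschitz g → Cauchy (riemannSum g 0ℚ 1ℚ)
riemannSum-cauchy {g} bl = geometric⇒Cauchy (riemannSum g 0ℚ 1ℚ) constant 0≤constant λ n →
    subst (λ z → ∣ riemannSum g 0ℚ 1ℚ (suc n) - riemannSum g 0ℚ 1ℚ n ∣ ℚ.≤ z ℚ.* ½^ n)
          (ℚₚ.*-identityʳ constant) (riemannSum-step bl n 0ℚ 1ℚ 0≤1)
  where open BoundedLipschitz bl

const-BL : ∀ c → BoundedLipschitz (λ _ → c)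
const-BL c = mkBL ∣ c ∣ (ℚₚ.0≤∣p∣ c) (λ _ → ℚₚ.≤-refl) 0ℚ ℚₚ.≤-refl λ s t →
  ℚₚ.≤-reflexive (trans (cong ∣_∣ (ℚₚ.+-inverseʳ c)) (sym (ℚₚ.*-zeroˡ ∣ s - t ∣)))

neg-BL : ∀ {g} → BoundedLipschitz g → BoundedLipschitz (λ t → ℚ.- g t)
neg-BL {g} (mkBL B 0≤B g≤B K 0≤K lip) = mkBL B 0≤B
  (λ s → subst (ℚ._≤ B) (sym (ℚₚ.∣-p∣≡∣p∣ (g s))) (g≤B s)) K 0≤K
  λ s t → subst (ℚ._≤ K ℚ.* ∣ s - t ∣)
    (trans (∣-∣-sym (g s) (g t)) (cong ∣_∣ (solve 2 (λ a b → b :- a := :- a :- :- b) refl (g s) (g t)))) (lip s t)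

+-BL : ∀ {f g} → BoundedLipschitz f → BoundedLipschitz g → BoundedLipschitz (λ t → f t ℚ.+ g t)
+-BL {f} {g} (mkBL B 0≤B f≤B K 0≤K lipf) (mkBL C 0≤C g≤C L 0≤L lipg) = mkBL (B ℚ.+ C) (0≤+ 0≤B 0≤C)
  (λ s → ℚₚ.≤-trans (ℚₚ.∣p+q∣≤∣p∣+∣q∣ (f s) (g s)) (ℚₚ.+-mono-≤ (f≤B s) (g≤C s)))
  (K ℚ.+ L) (0≤+ 0≤K 0≤L) λ s t → begin
    ∣ f s ℚ.+ g s - (f t ℚ.+ g t) ∣
      ≡⟨ cong ∣_∣ (solve 4 (λ a b c d → (a :+ b) :- (c :+ d) := (a :- c) :+ (b :- d)) refl (f s) (g s) (f t) (g t)) ⟩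
    ∣ (f s ℚ.- f t) ℚ.+ (g s ℚ.- g t) ∣
      ≤⟨ ℚₚ.∣p+q∣≤∣p∣+∣q∣ (f s ℚ.- f t) (g s ℚ.- g t) ⟩
    ∣ f s - f t ∣ ℚ.+ ∣ g s - g t ∣
      ≤⟨ ℚₚ.+-mono-≤ (lipf s t) (lipg s t) ⟩
    K ℚ.* ∣ s - t ∣ ℚ.+ L ℚ.* ∣ s - t ∣
      ≡⟨ sym (ℚₚ.*-distribʳ-+ ∣ s - t ∣ K L) ⟩
    (K ℚ.+ L) ℚ.* ∣ s - t ∣ ∎
  where open ≤-Reasoning

*-BL : ∀ {f g} → BoundedLipschitz f → BoundedLipschitz g → BoundedLipschitz (λ t → f t ℚ.* g t)
*-BL {f} {g} (mkBL B 0≤B f≤B K 0≤K lipf) (mkBL C 0≤C g≤C L 0≤L lipg) = mkBL (B ℚ.* C) (0≤* 0≤B 0≤C)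
  (λ s → subst (ℚ._≤ B ℚ.* C) (sym (ℚₚ.∣p*q∣≡∣p∣*∣q∣ (f s) (g s))) (*-mono-≤ (ℚₚ.0≤∣p∣ (g s)) 0≤B (f≤B s) (g≤C s)))
  (B ℚ.* L ℚ.+ C ℚ.* K) (0≤+ (0≤* 0≤B 0≤L) (0≤* 0≤C 0≤K)) λ s t → begin
    ∣ f s ℚ.* g s - f t ℚ.* g t ∣
      ≤⟨ ∣product-product∣ (f s) (g s) (f t) (g t) ⟩
    ∣ f s ∣ ℚ.* ∣ g s - g t ∣ ℚ.+ ∣ g t ∣ ℚ.* ∣ f s - f t ∣
      ≤⟨ ℚₚ.+-mono-≤ (*-mono-≤ (ℚₚ.0≤∣p∣ (g s ℚ.- g t)) 0≤B (f≤B s) (lipg s t))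
                     (*-mono-≤ (ℚₚ.0≤∣p∣ (f s ℚ.- f t)) 0≤C (g≤C t) (lipf s t)) ⟩
    B ℚ.* (L ℚ.* ∣ s - t ∣) ℚ.+ C ℚ.* (K ℚ.* ∣ s - t ∣)
      ≡⟨ solve 5 (λ B L C K d → B :* (L :* d) :+ C :* (K :* d) := (B :* L :+ C :* K) :* d) refl B L C K ∣ s - t ∣ ⟩
    (B ℚ.* L ℚ.+ C ℚ.* K) ℚ.* ∣ s - t ∣ ∎
  where open ≤-Reasoning

resp-BL : ∀ {f g} → (∀ t → f t ≡ g t) → BoundedLipschitz f → BoundedLipschitz g
resp-BL eq (mkBL B 0≤B f≤B K 0≤K lip) = mkBL B 0≤B (λ s → subst (λ z → ∣ z ∣ ℚ.≤ B) (eq s) (f≤B s)) K 0≤K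
  λ s t → subst₂ (λ u v → ∣ u - v ∣ ℚ.≤ K ℚ.* ∣ s - t ∣) (eq s) (eq t) (lip s t)

infixr 8 _^ℚ_
_^ℚ_ : ℚ → ℕ → ℚ
q ^ℚ zero  = 1ℚ
q ^ℚ suc n = q ℚ.* q ^ℚ n

^-BL : ∀ {g} → BoundedLipschitz g → ∀ n → BoundedLipschitz (λ t → g t ^ℚ n)
^-BL bl zero    = const-BL 1ℚ
^-BL bl (suc n) = *-BL bl (^-BL bl n)

0≤□ : ∀ t → 0ℚ ℚ.≤ t ℚ.* t
0≤□ t with ℚₚ.≤-total 0ℚ t
... | inj₁ 0≤t = 0≤* 0≤t 0≤t
... | inj₂ t≤0 = subst (0ℚ ℚ.≤_) (solve 1 (λ t → :- t :* :- t := t :* t) refl t) (0≤* 0≤-t 0≤-t)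
  where 0≤-t = ℚₚ.neg-antimono-≤ t≤0

1+t²>0 : ∀ t → 0ℚ ℚ.< 1ℚ ℚ.+ t ℚ.* t
1+t²>0 t = ℚₚ.+-mono-<-≤ (ℚₚ.positive⁻¹ 1ℚ) (0≤□ t)

v : ℚ → ℚ
v t = (1/ (1ℚ ℚ.+ t ℚ.* t)) {{ℚ.>-nonZero (1+t²>0 t)}}

-- γ(t) = ((1-t²)/(1+t²) , 2t/(1+t²)) maps [0,1] bijectively onto the arc of
-- the unit circle in the closed first quadrant, with speed |γ′(t)| = 2/(1+t²).

γx γy speed : ℚ → ℚ
γx t    = (1ℚ ℚ.- t ℚ.* t) ℚ.* v t
γy t    = 2ℚ ℚ.* t ℚ.* v t
speed t = 2ℚ ℚ.* v t

v-inverse : ∀ t → (1ℚ ℚ.+ t ℚ.* t) ℚ.* v t ≡ 1ℚ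
v-inverse t = ℚₚ.*-inverseʳ (1ℚ ℚ.+ t ℚ.* t) {{ℚ.>-nonZero (1+t²>0 t)}}

0≤v : ∀ t → 0ℚ ℚ.≤ v t
0≤v t = ℚₚ.<⇒≤ (ℚₚ.positive⁻¹ (v t) {{ℚₚ.1/pos⇒pos (1ℚ ℚ.+ t ℚ.* t) {{positive (1+t²>0 t)}}}})

∣v∣≤1 : ∀ t → ∣ v t ∣ ℚ.≤ 1ℚ
∣v∣≤1 t = begin
    ∣ v t ∣                         ≡⟨ ℚₚ.0≤p⇒∣p∣≡p (0≤v t) ⟩
    v t                             ≡⟨ sym (ℚₚ.+-identityʳ (v t)) ⟩
    v t ℚ.+ 0ℚ                      ≤⟨ ℚₚ.+-monoʳ-≤ (v t) (0≤* (0≤□ t) (0≤v t)) ⟩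
    v t ℚ.+ t ℚ.* t ℚ.* v t         ≡⟨ solve 2 (λ t v → v :+ t :* t :* v := (con 1ℚ :+ t :* t) :* v) refl t (v t) ⟩
    (1ℚ ℚ.+ t ℚ.* t) ℚ.* v t        ≡⟨ v-inverse t ⟩
    1ℚ ∎
  where open ≤-Reasoning

∣t∣≤1+t² : ∀ t → ∣ t ∣ ℚ.≤ 1ℚ ℚ.+ t ℚ.* t
∣t∣≤1+t² t with ℚₚ.≤-total ∣ t ∣ 1ℚ
... | inj₁ t≤1 = ℚₚ.≤-trans t≤1 (subst (ℚ._≤ 1ℚ ℚ.+ t ℚ.* t) (ℚₚ.+-identityʳ 1ℚ) (ℚₚ.+-monoʳ-≤ 1ℚ (0≤□ t)))
... | inj₂ 1≤t = begin
    ∣ t ∣                   ≡⟨ sym (ℚₚ.*-identityˡ ∣ t ∣) ⟩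
    1ℚ ℚ.* ∣ t ∣            ≤⟨ ℚₚ.*-monoʳ-≤-nonNeg ∣ t ∣ {{ℚₚ.∣-∣-nonNeg t}} 1≤t ⟩
    ∣ t ∣ ℚ.* ∣ t ∣         ≡⟨ sym (ℚₚ.∣p*q∣≡∣p∣*∣q∣ t t) ⟩
    ∣ t ℚ.* t ∣             ≡⟨ ℚₚ.0≤p⇒∣p∣≡p (0≤□ t) ⟩
    t ℚ.* t                 ≡⟨ sym (ℚₚ.+-identityˡ (t ℚ.* t)) ⟩
    0ℚ ℚ.+ t ℚ.* t          ≤⟨ ℚₚ.+-monoˡ-≤ (t ℚ.* t) 0≤1 ⟩
    1ℚ ℚ.+ t ℚ.* t ∎
  where open ≤-Reasoning

∣tv∣≤1 : ∀ t → ∣ t ℚ.* v t ∣ ℚ.≤ 1ℚ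
∣tv∣≤1 t = begin
    ∣ t ℚ.* v t ∣              ≡⟨ ℚₚ.∣p*q∣≡∣p∣*∣q∣ t (v t) ⟩
    ∣ t ∣ ℚ.* ∣ v t ∣          ≡⟨ cong (∣ t ∣ ℚ.*_) (ℚₚ.0≤p⇒∣p∣≡p (0≤v t)) ⟩
    ∣ t ∣ ℚ.* v t              ≤⟨ ℚₚ.*-monoʳ-≤-nonNeg (v t) {{nonNegative (0≤v t)}} (∣t∣≤1+t² t) ⟩
    (1ℚ ℚ.+ t ℚ.* t) ℚ.* v t   ≡⟨ v-inverse t ⟩
    1ℚ ∎
  where open ≤-Reasoning

∣ab∣≤1 : ∀ a b → ∣ a ∣ ℚ.≤ 1ℚ → ∣ b ∣ ℚ.≤ 1ℚ → ∣ a ℚ.* b ∣ ℚ.≤ 1ℚ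
∣ab∣≤1 a b a≤1 b≤1 = subst (ℚ._≤ 1ℚ) (sym (ℚₚ.∣p*q∣≡∣p∣*∣q∣ a b)) (*-mono-≤ (ℚₚ.0≤∣p∣ b) 0≤1 a≤1 b≤1)

∣[s-t][a+b]∣≤ : ∀ s t a b → ∣ a ∣ ℚ.≤ 1ℚ → ∣ b ∣ ℚ.≤ 1ℚ → ∣ (s ℚ.- t) ℚ.* (a ℚ.+ b) ∣ ℚ.≤ 2ℚ ℚ.* ∣ s - t ∣
∣[s-t][a+b]∣≤ s t a b a≤1 b≤1 = begin
    ∣ (s ℚ.- t) ℚ.* (a ℚ.+ b) ∣      ≡⟨ ℚₚ.∣p*q∣≡∣p∣*∣q∣ (s ℚ.- t) (a ℚ.+ b) ⟩
    ∣ s - t ∣ ℚ.* ∣ a ℚ.+ b ∣        ≤⟨ ℚₚ.*-monoˡ-≤-nonNeg ∣ s - t ∣ {{ℚₚ.∣-∣-nonNeg (s ℚ.- t)}}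
                                          (ℚₚ.≤-trans (ℚₚ.∣p+q∣≤∣p∣+∣q∣ a b) (ℚₚ.+-mono-≤ a≤1 b≤1)) ⟩
    ∣ s - t ∣ ℚ.* 2ℚ                 ≡⟨ ℚₚ.*-comm ∣ s - t ∣ 2ℚ ⟩
    2ℚ ℚ.* ∣ s - t ∣ ∎
  where open ≤-Reasoning

expand : ∀ x t → x ≡ x ℚ.* ((1ℚ ℚ.+ t ℚ.* t) ℚ.* v t)
expand x t = sym (trans (cong (x ℚ.*_) (v-inverse t)) (ℚₚ.*-identityʳ x))

v-BL : BoundedLipschitz v
v-BL = mkBL 1ℚ 0≤1 ∣v∣≤1 2ℚ 0≤2 λ s t →
  subst (ℚ._≤ 2ℚ ℚ.* ∣ s - t ∣) (sym (cong ∣_∣ (identity s t)))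
    (∣[s-t][a+b]∣≤ s t (ℚ.- (s ℚ.* v s ℚ.* v t)) (ℚ.- (t ℚ.* v t ℚ.* v s))
      (subst (ℚ._≤ 1ℚ) (sym (ℚₚ.∣-p∣≡∣p∣ (s ℚ.* v s ℚ.* v t))) (∣ab∣≤1 (s ℚ.* v s) (v t) (∣tv∣≤1 s) (∣v∣≤1 t)))
      (subst (ℚ._≤ 1ℚ) (sym (ℚₚ.∣-p∣≡∣p∣ (t ℚ.* v t ℚ.* v s))) (∣ab∣≤1 (t ℚ.* v t) (v s) (∣tv∣≤1 t) (∣v∣≤1 s))))
  where
    identity : ∀ s t → v s ℚ.- v t ≡ (s ℚ.- t) ℚ.* (ℚ.- (s ℚ.* v s ℚ.* v t) ℚ.+ ℚ.- (t ℚ.* v t ℚ.* v s))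
    identity s t = trans (cong₂ ℚ._-_ (expand (v s) t) (expand (v t) s))
      (solve 4 (λ s t a b → a :* ((con 1ℚ :+ t :* t) :* b) :- b :* ((con 1ℚ :+ s :* s) :* a)
         := (s :- t) :* (:- (s :* a :* b) :+ :- (t :* b :* a))) refl s t (v s) (v t))

tv-BL : BoundedLipschitz (λ t → t ℚ.* v t)
tv-BL = mkBL 1ℚ 0≤1 ∣tv∣≤1 2ℚ 0≤2 λ s t →
  subst (ℚ._≤ 2ℚ ℚ.* ∣ s - t ∣) (sym (cong ∣_∣ (identity s t)))
    (∣[s-t][a+b]∣≤ s t (v s ℚ.* v t) (ℚ.- (s ℚ.* v s ℚ.* (t ℚ.* v t)))
      (∣ab∣≤1 (v s) (v t) (∣v∣≤1 s) (∣v∣≤1 t))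
      (subst (ℚ._≤ 1ℚ) (sym (ℚₚ.∣-p∣≡∣p∣ (s ℚ.* v s ℚ.* (t ℚ.* v t))))
        (∣ab∣≤1 (s ℚ.* v s) (t ℚ.* v t) (∣tv∣≤1 s) (∣tv∣≤1 t))))
  where
    identity : ∀ s t → s ℚ.* v s ℚ.- t ℚ.* v t ≡ (s ℚ.- t) ℚ.* (v s ℚ.* v t ℚ.+ ℚ.- (s ℚ.* v s ℚ.* (t ℚ.* v t)))
    identity s t = trans (cong₂ ℚ._-_ (expand (s ℚ.* v s) t) (expand (t ℚ.* v t) s))
      (solve 4 (λ s t a b → s :* a :* ((con 1ℚ :+ t :* t) :* b) :- t :* b :* ((con 1ℚ :+ s :* s) :* a)
         := (s :- t) :* (a :* b :+ :- (s :* a :* (t :* b)))) refl s t (v s) (v t))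

speed-BL : BoundedLipschitz speed
speed-BL = *-BL (const-BL 2ℚ) v-BL

γx-BL : BoundedLipschitz γx
γx-BL = resp-BL (λ t → trans (cong (λ z → 2ℚ ℚ.* v t ℚ.- z) (sym (v-inverse t)))
    (solve 2 (λ t a → con 2ℚ :* a :- (con 1ℚ :+ t :* t) :* a := (con 1ℚ :- t :* t) :* a) refl t (v t)))
  (+-BL speed-BL (const-BL (ℚ.- 1ℚ)))

γy-BL : BoundedLipschitz γy
γy-BL = resp-BL (λ t → sym (ℚₚ.*-assoc 2ℚ t (v t))) (*-BL (const-BL 2ℚ) tv-BL)

-- The four summands are xⁱyʲ at γ(t) and at its successive quarter turns
-- (x,y) ↦ (-y,x), so that together they cover the whole circle.

monomialIntegrand : ℕ → ℕ → ℚ → ℚ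
monomialIntegrand i j t =
  (      γx t ^ℚ i ℚ.*       γy t ^ℚ j
   ℚ.+ (ℚ.- γy t) ^ℚ i ℚ.*       γx t ^ℚ j
   ℚ.+ (ℚ.- γx t) ^ℚ i ℚ.* (ℚ.- γy t) ^ℚ j
   ℚ.+       γy t ^ℚ i ℚ.* (ℚ.- γx t) ^ℚ j) ℚ.* speed t

monomialIntegrand-BL : ∀ i j → BoundedLipschitz (monomialIntegrand i j)
monomialIntegrand-BL i j = *-BL
  (+-BL (+-BL (+-BL
    (*-BL (^-BL γx-BL i) (^-BL γy-BL j))
    (*-BL (^-BL (neg-BL γy-BL) i) (^-BL γx-BL j)))
    (*-BL (^-BL (neg-BL γx-BL) i) (^-BL (neg-BL γy-BL) j)))
    (*-BL (^-BL γy-BL i) (^-BL (neg-BL γx-BL) j)))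
  speed-BL

-- ∫ xⁱyʲ dσ over the unit circle: the limit of the Riemann sums over [0,1]
-- of the integrand above.
∮monomial : ℕ → ℕ → ℝ
seq    (∮monomial i j) = riemannSum (monomialIntegrand i j) 0ℚ 1ℚ
cauchy (∮monomial i j) = riemannSum-cauchy (monomialIntegrand-BL i j)

ℝ² : Set
ℝ² = ℝ × ℝ

infix 4 _≈²_
_≈²_ : ℝ² → ℝ² → Set
(x , y) ≈² (x′ , y′) = x ≈ x′ × y ≈ y′

infixl 6 _⊕_
_⊕_ : ℝ² → ℝ² → ℝ²
(x , y) ⊕ (x′ , y′) = x + x′ , y + y′

infixr 7 _·_
_·_ : ℝ → ℝ² → ℝ²
r · (x , y) = r * x , r * y

⟨_,_⟩ : ℝ² → ℝ² → ℝ
⟨ (x , y) , (x′ , y′) ⟩ = x * x′ + y * y′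

-- (c , i , j) stands for the term c xⁱyʲ.
Polynomial : Set
Polynomial = List (ℝ × ℕ × ℕ)

DegreeAtMost : ℕ → Polynomial → Set
DegreeAtMost t = All λ (_ , i , j) → i ℕ.+ j ℕ.≤ t

evaluate : Polynomial → ℝ² → ℝ
evaluate f (x , y) = sum (map (λ (c , i , j) → c * (x ^ i * y ^ j)) f)

∮ : Polynomial → ℝ
∮ f = sum (map (λ (c , i , j) → c * ∮monomial i j) f)

∣S¹∣ : ℝ
∣S¹∣ = ∮ ((1ℝ , 0 , 0) ∷ [])

-- A subset of the plane is a predicate; it is finite when some duplicate-free
-- list of points (up to _≈²_) enumerates it.
record _Enumerates_ (xs : List ℝ²) (X : ℝ² → Set) : Set where
  field
    distinct : AllPairs (λ p q → ¬ p ≈² q) xs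
    sound    : All X xs
    complete : ∀ p → X p → Any (p ≈²_) xs

record IsUnitDesign (t : ℕ) (X : ℝ² → Set) : Set where
  field
    points   : List ℝ²
    finite   : points Enumerates X
    nonempty : points ≢ []
    onCircle : ∀ p → X p → ⟨ p , p ⟩ ≈ 1ℝ
    -- (1/|X|) Σ f(x) = (1/|S¹|) ∫ f dσ, with denominators cleared
    average  : ∀ f → DegreeAtMost t f →
               ∣S¹∣ * sum (map (evaluate f) points) ≈ fromℤ (+ length points) * ∮ f

-- For r > 0 the set (1/r)X is {p : rp ∈ X}.
_⁻¹·_ : ℝ → (ℝ² → Set) → ℝ² → Set
(r ⁻¹· X) p = X (r · p)

record IsSphericalDesign (t : ℕ) (X : ℝ² → Set) : Set where
  field
    radius   : ℝ
    0<radius : 0ℝ < radius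
    onSphere : ∀ p → X p → ⟨ p , p ⟩ ≈ radius * radius
    design   : IsUnitDesign t (radius ⁻¹· X)

A₂ : ℝ² → Set
A₂ p = ∃[ a ] ∃[ b ] p ≈² fromℤ a · (1ℝ , 0ℝ) ⊕ fromℤ b · (fromℚ ½ , fromℚ ½ * √3)

shell : ℝ → ℝ² → Set
shell m p = A₂ p × ⟨ p , p ⟩ ≈ m

{-# OPTIONS --safe #-}
module Submission where

-- On a shell of radius r the polynomial Re (x + iy)⁶ integrates to zero over the circle (a
-- quarter turn changes its sign), so a 6-design would have Σ z⁶ = 0 over all Eisenstein
-- integers z of norm n = r²; the sum is real because the shell is closed under conjugation.
-- Nonvanishing of S(n) = Σ z⁶ goes by induction on n.  Let π be an irreducible divisor of a
-- point of the shell.  If π ∣ π̄ then every point is divisible by π and S(n) = π⁶ S(n / ππ̄).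
-- Otherwise write n = (ππ̄)ᵏ m with m the norm of an element prime to π and π̄.  A point of norm
-- (ππ̄)ᵏ⁺¹ m is either π times a point of norm (ππ̄)ᵏ m or π̄ᵏ⁺¹ times a point of norm m, whence
-- S(n) = (Σ_{i+j=k} π⁶ⁱ π̄⁶ʲ) S(m); the first factor is π⁶ᵏ modulo π̄, hence nonzero.

open import Algebra.Bundles using (CommutativeRing)
open import Data.Bool using (if_then_else_)
open import Data.Integer as ℤ using (ℤ; +_; -[1+_]; 0ℤ; 1ℤ)
import Data.Integer.DivMod as ℤ
import Data.Integer.Properties as ℤₚ
open import Data.Integer.Tactic.RingSolver using (solve-∀)
open import Data.List using (List; []; _∷_; _++_; foldr; length; map)
open import Data.List.Membership.Propositional using (_∈_)
open import Data.List.Membership.Propositional.Properties using (∈-map⁺; ∈-map⁻; ∈-++⁺ˡ; ∈-++⁺ʳ; ∈-++⁻)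
open import Data.List.Membership.Propositional.Properties.WithK using (unique∧set⇒bag)
open import Data.List.Relation.Binary.BagAndSetEquality using (∼bag⇒↭)
open import Data.List.Relation.Binary.Permutation.Propositional as ↭ using (_↭_)
open import Data.List.Relation.Binary.Pointwise using (Pointwise; []; _∷_)
open import Data.List.Relation.Unary.All using (All; []; _∷_)
open import Data.List.Relation.Unary.AllPairs using (AllPairs; []; _∷_)
open import Data.List.Relation.Unary.Any using (Any; here; there)
import Data.List.Relation.Unary.Unique.DecPropositional as DecUnique
open import Data.List.Relation.Unary.Unique.Propositional using (Unique)
open import Data.List.Relation.Unary.Unique.Propositional.Properties using (map⁺; ++⁺)
open import Data.Nat as ℕ using (ℕ; zero; suc)
open import Data.Nat.Induction using (<-wellFounded)
import Data.Nat.Properties as ℕₚ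
import Data.Nat.Tactic.RingSolver as ℕ-Solver
open import Data.Product using (Σ; ∃; ∃-syntax; _×_; _,_; proj₁; proj₂)
open import Data.Rational as ℚ using (ℚ; 0ℚ; 1ℚ; ½; ∣_∣; nonNegative)
import Data.Rational.Properties as ℚₚ
open import Data.Rational.Solver using (module +-*-Solver)
import Data.Rational.Unnormalised.Base as ℚᵘ
import Data.Rational.Unnormalised.Properties as ℚᵘₚ
open import Data.Sum as Sum using (_⊎_; inj₁; inj₂)
open import Function using (_∘_; mk⇔)
open import Induction.WellFounded using (Acc; acc)
open import Level using (0ℓ)
open import Relation.Binary.Bundles using (Setoid)
open import Relation.Binary.Definitions using (DecidableEquality)
open import Relation.Binary.PropositionalEquality
  using (_≡_; _≢_; refl; sym; trans; cong; cong₂; subst; subst₂; isEquivalence; module ≡-Reasoning)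
import Relation.Binary.Reasoning.Setoid as SetoidReasoning
open import Relation.Nullary using (¬_; Dec; yes; no; contradiction; does)
open import Relation.Nullary.Decidable using (map′; _×-dec_; from-yes)

-- The terms z⁶ point in many directions, so neither size nor sign shows that their sum survives;
-- hence the argument by divisibility. The exponent 6 is the order of the unit group: u⁶ = 1 for
-- every unit u, so the induction starts from S(1) = 6, and x⁶ is unchanged when x is replaced by an
-- associate. A design is a statement about Cauchy reals, and its points have irrational
-- coordinates, while the induction takes place in a discrete ring. The bridge is that 2 Re z⁶ is an
-- integer polynomial in z + z̄ and z z̄. Both are integers at a lattice point, so the averaging
-- identity for one polynomial becomes an equation in ℤ, and √3 enters only through its square. Nor
-- is 2π ever identified: the integral of that polynomial vanishes, and the length of the circle is
-- bounded below and cancelled.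

module EisensteinIntegers where

  -- The ring of Eisenstein integers.

  infix 5 _+ω_

  -- a +ω b stands for a + b ω with ω = (1 + √-3) / 2, so that ω² = ω - 1.
  record 𝔼 : Set where
    constructor _+ω_
    field
      re : ℤ
      im : ℤ

  open 𝔼

  module CoordinateIdentities where
    open import Data.Integer using (_+_; _*_; _-_; -_)

    assoc-re : ∀ a b c d e f → (a * c - b * d) * e - (a * d + b * c + b * d) * f
                             ≡ a * (c * e - d * f) - b * (c * f + d * e + d * f)
    assoc-re = solve-∀
    assoc-im : ∀ a b c d e f → (a * c - b * d) * f + (a * d + b * c + b * d) * e + (a * d + b * c + b * d) * f
                             ≡ a * (c * f + d * e + d * f) + b * (c * e - d * f) + b * (c * f + d * e + d * f)
    assoc-im = solve-∀
    identityˡ-re : ∀ a b → 1ℤ * a - 0ℤ * b ≡ a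
    identityˡ-re = solve-∀
    identityˡ-im : ∀ a b → 1ℤ * b + 0ℤ * a + 0ℤ * b ≡ b
    identityˡ-im = solve-∀
    identityʳ-re : ∀ a b → a * 1ℤ - b * 0ℤ ≡ a
    identityʳ-re = solve-∀
    identityʳ-im : ∀ a b → a * 0ℤ + b * 1ℤ + b * 0ℤ ≡ b
    identityʳ-im = solve-∀
    distribˡ-re : ∀ a b c d e f → a * (c + e) - b * (d + f) ≡ a * c - b * d + (a * e - b * f)
    distribˡ-re = solve-∀
    distribˡ-im : ∀ a b c d e f → a * (d + f) + b * (c + e) + b * (d + f)
                                ≡ a * d + b * c + b * d + (a * f + b * e + b * f)
    distribˡ-im = solve-∀
    distribʳ-re : ∀ a b c d e f → (c + e) * a - (d + f) * b ≡ c * a - d * b + (e * a - f * b)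
    distribʳ-re = solve-∀
    distribʳ-im : ∀ a b c d e f → (c + e) * b + (d + f) * a + (d + f) * b
                                ≡ c * b + d * a + d * b + (e * b + f * a + f * b)
    distribʳ-im = solve-∀
    comm-re : ∀ a b c d → a * c - b * d ≡ c * a - d * b
    comm-re = solve-∀
    comm-im : ∀ a b c d → a * d + b * c + b * d ≡ c * b + d * a + d * b
    comm-im = solve-∀
    conj-re : ∀ a b c d → a * c - b * d + (a * d + b * c + b * d) ≡ (a + b) * (c + d) - - b * - d
    conj-re = solve-∀
    conj-im : ∀ a b c d → - (a * d + b * c + b * d) ≡ (a + b) * - d + - b * (c + d) + - b * - d
    conj-im = solve-∀
    conj-involutive-re : ∀ a b → a + b + - b ≡ a
    conj-involutive-re = solve-∀
    conj-involutive-im : ∀ b → - - b ≡ b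
    conj-involutive-im = solve-∀
    norm-re : ∀ a b → a * (a + b) - b * - b ≡ a * a + a * b + b * b
    norm-re = solve-∀
    norm-im : ∀ a b → a * - b + b * (a + b) + b * - b ≡ 0ℤ
    norm-im = solve-∀
    norm-* : ∀ a b c d → let e = a * c - b * d; f = a * d + b * c + b * d in
      e * e + e * f + f * f ≡ (a * a + a * b + b * b) * (c * c + c * d + d * d)
    norm-* = solve-∀
    norm-conj : ∀ a b → (a + b) * (a + b) + (a + b) * - b + - b * - b ≡ a * a + a * b + b * b
    norm-conj = solve-∀
    4norm : ∀ a b → + 4 * (a * a + a * b + b * b) ≡ (a + (a + b)) * (a + (a + b)) + + 3 * (b * b)
    4norm = solve-∀
    norm-swap : ∀ a b → a * a + a * b + b * b ≡ b * b + b * a + a * a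
    norm-swap = solve-∀

  infixl 6 _+_
  infixl 7 _*_
  infix  8 -_

  _+_ _*_ : 𝔼 → 𝔼 → 𝔼
  (a +ω b) + (c +ω d) = a ℤ.+ c +ω b ℤ.+ d
  (a +ω b) * (c +ω d) = a ℤ.* c ℤ.- b ℤ.* d +ω a ℤ.* d ℤ.+ b ℤ.* c ℤ.+ b ℤ.* d

  -_ conj : 𝔼 → 𝔼
  - (a +ω b)    = ℤ.- a +ω ℤ.- b
  conj (a +ω b) = a ℤ.+ b +ω ℤ.- b

  ι : ℤ → 𝔼
  ι a = a +ω 0ℤ

  +-*-commutativeRing : CommutativeRing 0ℓ 0ℓ
  +-*-commutativeRing = record
    { Carrier = 𝔼
    ; _≈_ = _≡_
    ; _+_ = _+_
    ; _*_ = _*_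
    ; -_ = -_
    ; 0# = ι 0ℤ
    ; 1# = ι 1ℤ
    ; isCommutativeRing = record
      { isRing = record
        { +-isAbelianGroup = record
          { isGroup = record
            { isMonoid = record
              { isSemigroup = record
                { isMagma = record { isEquivalence = isEquivalence ; ∙-cong = cong₂ _+_ }
                ; assoc = λ x y z → cong₂ _+ω_ (ℤₚ.+-assoc (re x) (re y) (re z)) (ℤₚ.+-assoc (im x) (im y) (im z)) }
              ; identity = (λ x → cong₂ _+ω_ (ℤₚ.+-identityˡ (re x)) (ℤₚ.+-identityˡ (im x)))
                         , (λ x → cong₂ _+ω_ (ℤₚ.+-identityʳ (re x)) (ℤₚ.+-identityʳ (im x))) }
            ; inverse = (λ x → cong₂ _+ω_ (ℤₚ.+-inverseˡ (re x)) (ℤₚ.+-inverseˡ (im x)))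
                      , (λ x → cong₂ _+ω_ (ℤₚ.+-inverseʳ (re x)) (ℤₚ.+-inverseʳ (im x)))
            ; ⁻¹-cong = cong -_ }
          ; comm = λ x y → cong₂ _+ω_ (ℤₚ.+-comm (re x) (re y)) (ℤₚ.+-comm (im x) (im y)) }
        ; *-cong = cong₂ _*_
        ; *-assoc = λ (a +ω b) (c +ω d) (e +ω f) → cong₂ _+ω_ (assoc-re a b c d e f) (assoc-im a b c d e f)
        ; *-identity = (λ (a +ω b) → cong₂ _+ω_ (identityˡ-re a b) (identityˡ-im a b))
                     , (λ (a +ω b) → cong₂ _+ω_ (identityʳ-re a b) (identityʳ-im a b))
        ; distrib = (λ (a +ω b) (c +ω d) (e +ω f) → cong₂ _+ω_ (distribˡ-re a b c d e f) (distribˡ-im a b c d e f))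
                  , (λ (a +ω b) (c +ω d) (e +ω f) → cong₂ _+ω_ (distribʳ-re a b c d e f) (distribʳ-im a b c d e f)) }
      ; *-comm = λ (a +ω b) (c +ω d) → cong₂ _+ω_ (comm-re a b c d) (comm-im a b c d) } }
    where open CoordinateIdentities

  open CommutativeRing +-*-commutativeRing
    using ( 0#; 1#; _-_; +-assoc; +-comm; +-identityˡ; *-assoc; *-comm; *-identityˡ; *-identityʳ
          ; distribˡ; distribʳ; zeroˡ; zeroʳ; ring; semiring; commutativeSemiring; *-commutativeSemigroup)
  open import Algebra.Properties.Ring ring
    using (x[y-z]≈xy-xz; [y-z]x≈yx-zx; x∙y⁻¹≈ε⇒x≈y; x≈y⇒x∙y⁻¹≈ε; //-rightDividesˡ; //-rightDividesʳ)
  open import Algebra.Properties.CommutativeSemigroup *-commutativeSemigroup using (x∙yz≈y∙xz)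
  open import Algebra.Properties.CommutativeSemigroup.Divisibility *-commutativeSemigroup
    using (_∣_; _∤_; _,_; x∣xy; x∣ʳyx; ∣ʳ-trans; x∣ʳy⇒x∣ʳzy; ∣ʳ-respʳ-≈; x∣y⇒zx∣zy)
  open import Algebra.Properties.Semiring.Divisibility semiring using (_∣0; 0∣x⇒x≈0)
  open import Algebra.Properties.CommutativeSemiring.Exp commutativeSemiring using (_^_; ^-distrib-*; ^-homo-*)

  -- The norm: multiplicativity, positivity and bounds on the coordinates.

  norm : 𝔼 → ℤ
  norm (a +ω b) = a ℤ.* a ℤ.+ a ℤ.* b ℤ.+ b ℤ.* b

  ∥_∥ : 𝔼 → ℕ
  ∥ x ∥ = ℤ.∣ norm x ∣

  conj-* : ∀ x y → conj (x * y) ≡ conj x * conj y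
  conj-* (a +ω b) (c +ω d) = cong₂ _+ω_ (conj-re a b c d) (conj-im a b c d)
    where open CoordinateIdentities

  conj-^ : ∀ x n → conj (x ^ n) ≡ conj x ^ n
  conj-^ x zero    = refl
  conj-^ x (suc n) = trans (conj-* x (x ^ n)) (cong (conj x *_) (conj-^ x n))

  conj-involutive : ∀ x → conj (conj x) ≡ x
  conj-involutive (a +ω b) = cong₂ _+ω_ (conj-involutive-re a b) (conj-involutive-im b)
    where open CoordinateIdentities

  x*conj[x]≡ι[norm] : ∀ x → x * conj x ≡ ι (norm x)
  x*conj[x]≡ι[norm] (a +ω b) = cong₂ _+ω_ (norm-re a b) (norm-im a b)
    where open CoordinateIdentities

  norm-* : ∀ x y → norm (x * y) ≡ norm x ℤ.* norm y
  norm-* (a +ω b) (c +ω d) = CoordinateIdentities.norm-* a b c d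

  ∥∥-* : ∀ x y → ∥ x * y ∥ ≡ ∥ x ∥ ℕ.* ∥ y ∥
  ∥∥-* x y = trans (cong ℤ.∣_∣ (norm-* x y)) (ℤₚ.abs-* (norm x) (norm y))

  ∥∥-^ : ∀ x n → ∥ x ^ n ∥ ≡ ∥ x ∥ ℕ.^ n
  ∥∥-^ x zero    = refl
  ∥∥-^ x (suc n) = trans (∥∥-* x (x ^ n)) (cong (∥ x ∥ ℕ.*_) (∥∥-^ x n))

  ∥∥-conj : ∀ x → ∥ conj x ∥ ≡ ∥ x ∥
  ∥∥-conj (a +ω b) = cong ℤ.∣_∣ (CoordinateIdentities.norm-conj a b)

  i*i≡+∣i∣*∣i∣ : ∀ i → i ℤ.* i ≡ + (ℤ.∣ i ∣ ℕ.* ℤ.∣ i ∣)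
  i*i≡+∣i∣*∣i∣ (+ n)    = sym (ℤₚ.pos-* n n)
  i*i≡+∣i∣*∣i∣ -[1+ n ] = refl

  -- Completing the square: 4 (a² + ab + b²) = (2a + b)² + 3b². A sum of naturals on the right
  -- yields both the positivity of the norm and the bound on `im x`.
  4norm≡ : ∀ x → + 4 ℤ.* norm x ≡ + (ℤ.∣ re x ℤ.+ (re x ℤ.+ im x) ∣ ℕ.* ℤ.∣ re x ℤ.+ (re x ℤ.+ im x) ∣
                                      ℕ.+ 3 ℕ.* (ℤ.∣ im x ∣ ℕ.* ℤ.∣ im x ∣))
  4norm≡ (a +ω b) = begin
    + 4 ℤ.* norm (a +ω b)                                     ≡⟨ CoordinateIdentities.4norm a b ⟩
    t ℤ.* t ℤ.+ + 3 ℤ.* (b ℤ.* b)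
      ≡⟨ cong₂ (λ u v → u ℤ.+ + 3 ℤ.* v) (i*i≡+∣i∣*∣i∣ t) (i*i≡+∣i∣*∣i∣ b) ⟩
    + (ℤ.∣ t ∣ ℕ.* ℤ.∣ t ∣) ℤ.+ + 3 ℤ.* + (ℤ.∣ b ∣ ℕ.* ℤ.∣ b ∣)
      ≡⟨ cong (λ z → + (ℤ.∣ t ∣ ℕ.* ℤ.∣ t ∣) ℤ.+ z) (ℤₚ.pos-* 3 (ℤ.∣ b ∣ ℕ.* ℤ.∣ b ∣)) ⟨
    + (ℤ.∣ t ∣ ℕ.* ℤ.∣ t ∣ ℕ.+ 3 ℕ.* (ℤ.∣ b ∣ ℕ.* ℤ.∣ b ∣))   ∎
    where
    open ≡-Reasoning
    t = a ℤ.+ (a ℤ.+ b)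

  norm≡+∥∥ : ∀ x → norm x ≡ + ∥ x ∥
  norm≡+∥∥ x = sym (ℤₚ.0≤i⇒+∣i∣≡i (ℤₚ.*-cancelˡ-≤-pos 0ℤ (norm x) (+ 4)
    (subst (0ℤ ℤ.≤_) (sym (4norm≡ x)) (ℤ.+≤+ ℕ.z≤n))))

  4∥∥≡ : ∀ x → 4 ℕ.* ∥ x ∥ ≡ ℤ.∣ re x ℤ.+ (re x ℤ.+ im x) ∣ ℕ.* ℤ.∣ re x ℤ.+ (re x ℤ.+ im x) ∣
                             ℕ.+ 3 ℕ.* (ℤ.∣ im x ∣ ℕ.* ℤ.∣ im x ∣)
  4∥∥≡ x = trans (sym (ℤₚ.abs-* (+ 4) (norm x))) (cong ℤ.∣_∣ (4norm≡ x))

  3∣im∣²≤4∥∥ : ∀ x → 3 ℕ.* (ℤ.∣ im x ∣ ℕ.* ℤ.∣ im x ∣) ℕ.≤ 4 ℕ.* ∥ x ∥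
  3∣im∣²≤4∥∥ x = ℕₚ.≤-trans (ℕₚ.m≤n+m _ (ℤ.∣ re x ℤ.+ (re x ℤ.+ im x) ∣ ℕ.* ℤ.∣ re x ℤ.+ (re x ℤ.+ im x) ∣))
    (ℕₚ.≤-reflexive (sym (4∥∥≡ x)))

  3∣re∣²≤4∥∥ : ∀ x → 3 ℕ.* (ℤ.∣ re x ∣ ℕ.* ℤ.∣ re x ∣) ℕ.≤ 4 ℕ.* ∥ x ∥
  3∣re∣²≤4∥∥ (a +ω b) = subst (λ n → _ ℕ.≤ 4 ℕ.* ℤ.∣ n ∣) (CoordinateIdentities.norm-swap b a) (3∣im∣²≤4∥∥ (b +ω a))

  -- For n ≥ 2 use 4n ≤ 3 · 2 · n ≤ 3n². This chain fails at n = 1, where 3 ≤ 4m merely has to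
  -- exclude m = 0.
  3n²≤4m⇒n≤m : ∀ n m → 3 ℕ.* (n ℕ.* n) ℕ.≤ 4 ℕ.* m → n ℕ.≤ m
  3n²≤4m⇒n≤m zero          m       p = ℕ.z≤n
  3n²≤4m⇒n≤m (suc zero)    zero    ()
  3n²≤4m⇒n≤m (suc zero)    (suc m) p = ℕ.s≤s ℕ.z≤n
  3n²≤4m⇒n≤m n@(suc (suc k)) m       p = ℕₚ.*-cancelˡ-≤ 4 (ℕₚ.≤-trans
    (ℕₚ.≤-trans (ℕₚ.*-monoˡ-≤ n (ℕ.s≤s (ℕ.s≤s (ℕ.s≤s (ℕ.s≤s (ℕ.z≤n {2}))))))
      (ℕₚ.≤-trans (ℕₚ.≤-reflexive (ℕₚ.*-assoc 3 2 n)) (ℕₚ.*-monoʳ-≤ 3 (ℕₚ.*-monoˡ-≤ n (ℕ.s≤s (ℕ.s≤s (ℕ.z≤n {k}))))))) p)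

  ∣re∣≤∥∥ : ∀ x → ℤ.∣ re x ∣ ℕ.≤ ∥ x ∥
  ∣re∣≤∥∥ x = 3n²≤4m⇒n≤m _ _ (3∣re∣²≤4∥∥ x)

  ∣im∣≤∥∥ : ∀ x → ℤ.∣ im x ∣ ℕ.≤ ∥ x ∥
  ∣im∣≤∥∥ x = 3n²≤4m⇒n≤m _ _ (3∣im∣²≤4∥∥ x)

  ∥x∥≡0⇒x≡0 : ∀ x → ∥ x ∥ ≡ 0 → x ≡ 0#
  ∥x∥≡0⇒x≡0 x eq = cong₂ _+ω_
    (ℤₚ.∣i∣≡0⇒i≡0 (ℕₚ.n≤0⇒n≡0 (ℕₚ.≤-trans (∣re∣≤∥∥ x) (ℕₚ.≤-reflexive eq))))
    (ℤₚ.∣i∣≡0⇒i≡0 (ℕₚ.n≤0⇒n≡0 (ℕₚ.≤-trans (∣im∣≤∥∥ x) (ℕₚ.≤-reflexive eq))))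

  x≢0⇒∥x∥>0 : ∀ x → x ≢ 0# → 0 ℕ.< ∥ x ∥
  x≢0⇒∥x∥>0 x x≢0 = ℕₚ.n≢0⇒n>0 λ eq → x≢0 (∥x∥≡0⇒x≡0 x eq)

  x*y≡0⇒x≡0∨y≡0 : ∀ x y → x * y ≡ 0# → x ≡ 0# ⊎ y ≡ 0#
  x*y≡0⇒x≡0∨y≡0 x y eq = Sum.map (∥x∥≡0⇒x≡0 x) (∥x∥≡0⇒x≡0 y)
    (ℕₚ.m*n≡0⇒m≡0∨n≡0 ∥ x ∥ (trans (sym (∥∥-* x y)) (cong ∥_∥ eq)))

  *-cancelˡ : ∀ x {y z} → x ≢ 0# → x * y ≡ x * z → y ≡ z
  *-cancelˡ x {y} {z} x≢0 eq = Sum.[ (λ x≡0 → contradiction x≡0 x≢0) , x∙y⁻¹≈ε⇒x≈y y z ]′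
    (x*y≡0⇒x≡0∨y≡0 x (y - z) (trans (x[y-z]≈xy-xz x y z) (x≈y⇒x∙y⁻¹≈ε eq)))

  -- Euclidean division.

  nearestMultiple : ∀ i n .{{_ : ℕ.NonZero n}} → ∃[ t ] 2 ℕ.* ℤ.∣ i ℤ.- t ℤ.* + n ∣ ℕ.≤ n
  nearestMultiple i n = t , (begin
    2 ℕ.* ℤ.∣ i ℤ.- t ℤ.* + n ∣        ≡⟨ ℤₚ.abs-* (+ 2) (i ℤ.- t ℤ.* + n) ⟨
    ℤ.∣ + 2 ℤ.* (i ℤ.- t ℤ.* + n) ∣    ≡⟨ cong ℤ.∣_∣ (double i t (+ n)) ⟩
    ℤ.∣ 2i+n ℤ.- t ℤ.* (+ n ℤ.+ + n) ℤ.- + n ∣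
      ≡⟨ cong (λ z → ℤ.∣ z ℤ.- t ℤ.* (+ n ℤ.+ + n) ℤ.- + n ∣) (ℤ.a≡a%ℕn+[a/ℕn]*n 2i+n (n ℕ.+ n)) ⟩
    ℤ.∣ + s ℤ.+ t ℤ.* + (n ℕ.+ n) ℤ.- t ℤ.* (+ n ℤ.+ + n) ℤ.- + n ∣
      ≡⟨ cong (λ z → ℤ.∣ z ℤ.- + n ∣) (cancel (+ s) (t ℤ.* + (n ℕ.+ n))) ⟩
    ℤ.∣ + s ℤ.- + n ∣                  ≡⟨ cong ℤ.∣_∣ (ℤₚ.m-n≡m⊖n s n) ⟩
    ℤ.∣ s ℤ.⊖ n ∣                      ≤⟨ bound ⟩
    n                                  ∎)
    where
    open ℕₚ.≤-Reasoning
    instance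
      2n≢0 : ℕ.NonZero (n ℕ.+ n)
      2n≢0 = ℕ.>-nonZero (ℕₚ.<-≤-trans (ℕ.>-nonZero⁻¹ n) (ℕₚ.m≤m+n n n))
    -- Rounding i / n to the nearest integer is taking the floor of (2i + n) / 2n. The remainder `s`
    -- lies in [0, 2n), and twice the error is s - n.
    2i+n = + 2 ℤ.* i ℤ.+ + n
    t = 2i+n ℤ./ℕ (n ℕ.+ n)
    s = 2i+n ℤ.%ℕ (n ℕ.+ n)
    double : ∀ i t n → + 2 ℤ.* (i ℤ.- t ℤ.* n) ≡ + 2 ℤ.* i ℤ.+ n ℤ.- t ℤ.* (n ℤ.+ n) ℤ.- n
    double = solve-∀
    cancel : ∀ s u → s ℤ.+ u ℤ.- u ≡ s
    cancel = solve-∀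
    bound : ℤ.∣ s ℤ.⊖ n ∣ ℕ.≤ n
    bound with ℕₚ.≤-total s n
    ... | inj₁ s≤n = subst (ℕ._≤ n) (sym (ℤₚ.∣⊖∣-≤ s≤n)) (ℕₚ.m∸n≤m n s)
    ... | inj₂ n≤s = subst (ℕ._≤ n) (sym (trans (ℤₚ.∣m⊖n∣≡∣n⊖m∣ s n) (ℤₚ.∣⊖∣-≤ n≤s)))
                       (ℕₚ.m≤n+o⇒m∸n≤o s n (ℕₚ.<⇒≤ (ℤ.n%ℕd<d 2i+n (n ℕ.+ n))))

  ∥a+bω∥≤ : ∀ a b → ∥ a +ω b ∥ ℕ.≤ ℤ.∣ a ∣ ℕ.* ℤ.∣ a ∣ ℕ.+ ℤ.∣ a ∣ ℕ.* ℤ.∣ b ∣ ℕ.+ ℤ.∣ b ∣ ℕ.* ℤ.∣ b ∣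
  ∥a+bω∥≤ a b = begin
    ℤ.∣ a ℤ.* a ℤ.+ a ℤ.* b ℤ.+ b ℤ.* b ∣                 ≤⟨ ℤₚ.∣i+j∣≤∣i∣+∣j∣ (a ℤ.* a ℤ.+ a ℤ.* b) (b ℤ.* b) ⟩
    ℤ.∣ a ℤ.* a ℤ.+ a ℤ.* b ∣ ℕ.+ ℤ.∣ b ℤ.* b ∣           ≤⟨ ℕₚ.+-monoˡ-≤ _ (ℤₚ.∣i+j∣≤∣i∣+∣j∣ (a ℤ.* a) (a ℤ.* b)) ⟩
    ℤ.∣ a ℤ.* a ∣ ℕ.+ ℤ.∣ a ℤ.* b ∣ ℕ.+ ℤ.∣ b ℤ.* b ∣
      ≡⟨ cong₂ ℕ._+_ (cong₂ ℕ._+_ (ℤₚ.abs-* a a) (ℤₚ.abs-* a b)) (ℤₚ.abs-* b b) ⟩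
    ℤ.∣ a ∣ ℕ.* ℤ.∣ a ∣ ℕ.+ ℤ.∣ a ∣ ℕ.* ℤ.∣ b ∣ ℕ.+ ℤ.∣ b ∣ ℕ.* ℤ.∣ b ∣ ∎
    where open ℕₚ.≤-Reasoning

  -- This is why the ring is Euclidean: coordinates of size at most 1/2 give a norm of at most 3/4,
  -- and the missing quarter makes the inequality strict.
  2u≤n∧2v≤n⇒u²+uv+v²<n² : ∀ {u v n} .{{_ : ℕ.NonZero n}} → 2 ℕ.* u ℕ.≤ n → 2 ℕ.* v ℕ.≤ n →
                          u ℕ.* u ℕ.+ u ℕ.* v ℕ.+ v ℕ.* v ℕ.< n ℕ.* n
  2u≤n∧2v≤n⇒u²+uv+v²<n² {u} {v} {n} 2u≤n 2v≤n = ℕₚ.*-cancelˡ-< 4 _ _ (begin-strict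
    4 ℕ.* (u ℕ.* u ℕ.+ u ℕ.* v ℕ.+ v ℕ.* v) ≡⟨ expand u v ⟩
    2 ℕ.* u ℕ.* (2 ℕ.* u) ℕ.+ 2 ℕ.* u ℕ.* (2 ℕ.* v) ℕ.+ 2 ℕ.* v ℕ.* (2 ℕ.* v)
      ≤⟨ ℕₚ.+-mono-≤ (ℕₚ.+-mono-≤ (ℕₚ.*-mono-≤ 2u≤n 2u≤n) (ℕₚ.*-mono-≤ 2u≤n 2v≤n)) (ℕₚ.*-mono-≤ 2v≤n 2v≤n) ⟩
    n ℕ.* n ℕ.+ n ℕ.* n ℕ.+ n ℕ.* n         <⟨ ℕₚ.m<m+n (n ℕ.* n ℕ.+ n ℕ.* n ℕ.+ n ℕ.* n) (ℕₚ.*-mono-< 0<n 0<n) ⟩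
    n ℕ.* n ℕ.+ n ℕ.* n ℕ.+ n ℕ.* n ℕ.+ n ℕ.* n ≡⟨ collect (n ℕ.* n) ⟩
    4 ℕ.* (n ℕ.* n)                         ∎)
    where
    open ℕₚ.≤-Reasoning
    0<n = ℕ.>-nonZero⁻¹ n
    expand : ∀ u v → 4 ℕ.* (u ℕ.* u ℕ.+ u ℕ.* v ℕ.+ v ℕ.* v)
                   ≡ 2 ℕ.* u ℕ.* (2 ℕ.* u) ℕ.+ 2 ℕ.* u ℕ.* (2 ℕ.* v) ℕ.+ 2 ℕ.* v ℕ.* (2 ℕ.* v)
    expand = ℕ-Solver.solve-∀
    collect : ∀ k → k ℕ.+ k ℕ.+ k ℕ.+ k ≡ 4 ℕ.* k
    collect = ℕ-Solver.solve-∀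

  -- The quotient is x * conj d / ∥d∥ with both coordinates rounded.
  division : ∀ x d → d ≢ 0# → ∃[ q ] ∥ x - q * d ∥ ℕ.< ∥ d ∥
  -- Multiplying the remainder by `conj d` turns its coordinates into the rounding errors `u` and
  -- `v`, each at most n / 2 in absolute value.
  division x d d≢0 = q , ℕₚ.*-cancelʳ-< _ _ n (begin-strict
    ∥ r ∥ ℕ.* ∥ d ∥              ≡⟨ cong (∥ r ∥ ℕ.*_) (∥∥-conj d) ⟨
    ∥ r ∥ ℕ.* ∥ conj d ∥         ≡⟨ ∥∥-* r (conj d) ⟨
    ∥ r * conj d ∥               ≡⟨ cong ∥_∥ r*conj[d] ⟩
    ∥ u +ω v ∥                   ≤⟨ ∥a+bω∥≤ u v ⟩
    ℤ.∣ u ∣ ℕ.* ℤ.∣ u ∣ ℕ.+ ℤ.∣ u ∣ ℕ.* ℤ.∣ v ∣ ℕ.+ ℤ.∣ v ∣ ℕ.* ℤ.∣ v ∣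
                                 <⟨ 2u≤n∧2v≤n⇒u²+uv+v²<n² {ℤ.∣ u ∣} {ℤ.∣ v ∣} (proj₂ near-re) (proj₂ near-im) ⟩
    n ℕ.* n                      ∎)
    where
    open ℕₚ.≤-Reasoning
    n = ∥ d ∥
    instance
      n≢0 : ℕ.NonZero n
      n≢0 = ℕ.>-nonZero (x≢0⇒∥x∥>0 d d≢0)
    y = x * conj d
    near-re = nearestMultiple (re y) n
    near-im = nearestMultiple (im y) n
    q = proj₁ near-re +ω proj₁ near-im
    r = x - q * d
    u = re y ℤ.- re q ℤ.* + n
    v = im y ℤ.- im q ℤ.* + n
    scale-re : ∀ y a b n → y ℤ.+ ℤ.- (a ℤ.* n ℤ.- b ℤ.* 0ℤ) ≡ y ℤ.- a ℤ.* n
    scale-re = solve-∀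
    scale-im : ∀ y a b n → y ℤ.+ ℤ.- (a ℤ.* 0ℤ ℤ.+ b ℤ.* n ℤ.+ b ℤ.* 0ℤ) ≡ y ℤ.- b ℤ.* n
    scale-im = solve-∀
    r*conj[d] : r * conj d ≡ u +ω v
    r*conj[d] = trans ([y-z]x≈yx-zx (conj d) x (q * d))
      (trans (cong (λ z → y - z) (*-assoc q d (conj d)))
      (trans (cong (λ z → y - q * z) (trans (x*conj[x]≡ι[norm] d) (cong ι (norm≡+∥∥ d))))
      (cong₂ _+ω_ (scale-re (re y) (re q) (im q) (+ n)) (scale-im (im y) (re q) (im q) (+ n)))))

  -- Divisibility, greatest common divisors and irreducible elements.

  d∣x∧d∣y⇒d∣x+y : ∀ {d x y} → d ∣ x → d ∣ y → d ∣ x + y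
  d∣x∧d∣y⇒d∣x+y {d} (q , qd≡x) (r , rd≡y) = q + r , trans (distribʳ d q r) (cong₂ _+_ qd≡x rd≡y)

  d∣x∧d∣y⇒d∣x-y : ∀ {d x y} → d ∣ x → d ∣ y → d ∣ x - y
  d∣x∧d∣y⇒d∣x-y {d} (q , qd≡x) (r , rd≡y) = q - r , trans ([y-z]x≈yx-zx d q r) (cong₂ _-_ qd≡x rd≡y)

  d∣x+y∧d∣y⇒d∣x : ∀ {d} x y → d ∣ x + y → d ∣ y → d ∣ x
  d∣x+y∧d∣y⇒d∣x x y d∣x+y d∣y = ∣ʳ-respʳ-≈ (//-rightDividesʳ y x) (d∣x∧d∣y⇒d∣x-y d∣x+y d∣y)

  d∣x-y∧d∣y⇒d∣x : ∀ {d} x y → d ∣ x - y → d ∣ y → d ∣ x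
  d∣x-y∧d∣y⇒d∣x x y d∣x-y d∣y = ∣ʳ-respʳ-≈ (//-rightDividesˡ y x) (d∣x∧d∣y⇒d∣x+y d∣x-y d∣y)

  conj-∣ : ∀ {d x} → d ∣ x → conj d ∣ conj x
  conj-∣ {d} (q , qd≡x) = conj q , trans (sym (conj-* q d)) (cong conj qd≡x)

  ∣-quotient-∥∥ : ∀ {d x} ((q , _) : d ∣ x) → ∥ x ∥ ≡ ∥ q ∥ ℕ.* ∥ d ∥
  ∣-quotient-∥∥ {d} (q , qd≡x) = trans (cong ∥_∥ (sym qd≡x)) (∥∥-* q d)

  ∥u∥≡1⇒conj[u]*u≡1 : ∀ u → ∥ u ∥ ≡ 1 → conj u * u ≡ 1#
  ∥u∥≡1⇒conj[u]*u≡1 u eq = begin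
    conj u * u  ≡⟨ *-comm (conj u) u ⟩
    u * conj u  ≡⟨ x*conj[x]≡ι[norm] u ⟩
    ι (norm u)  ≡⟨ cong ι (norm≡+∥∥ u) ⟩
    ι (+ ∥ u ∥) ≡⟨ cong (ι ∘ +_) eq ⟩
    1#          ∎
    where open ≡-Reasoning

  -- The quotient has norm 1, so its conjugate is its inverse.
  ∥d∥≡∥x∥∧d∣x⇒x∣d : ∀ {d x} → x ≢ 0# → ∥ d ∥ ≡ ∥ x ∥ → d ∣ x → x ∣ d
  ∥d∥≡∥x∥∧d∣x⇒x∣d {d} {x} x≢0 eq d∣x@(q , qd≡x) = conj q , (begin
    conj q * x        ≡⟨ cong (conj q *_) qd≡x ⟨
    conj q * (q * d)  ≡⟨ *-assoc (conj q) q d ⟨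
    conj q * q * d    ≡⟨ cong (_* d) (∥u∥≡1⇒conj[u]*u≡1 q ∥q∥≡1) ⟩
    1# * d            ≡⟨ *-identityˡ d ⟩
    d                 ∎)
    where
    open ≡-Reasoning
    ∥q∥≡1 : ∥ q ∥ ≡ 1
    ∥q∥≡1 = ℕₚ.*-cancelʳ-≡ (∥ q ∥) 1 (∥ x ∥) {{ℕ.>-nonZero (x≢0⇒∥x∥>0 x x≢0)}}
      (trans (cong (∥ q ∥ ℕ.*_) (sym eq)) (trans (sym (∣-quotient-∥∥ d∣x)) (sym (ℕₚ.*-identityˡ ∥ x ∥))))

  ∥x∥<∥d∥∧d∣x⇒x≡0 : ∀ {d x} → ∥ x ∥ ℕ.< ∥ d ∥ → d ∣ x → x ≡ 0#
  ∥x∥<∥d∥∧d∣x⇒x≡0 {d} {x} x<d d∣x@(q , qd≡x) = trans (sym qd≡x) (trans (cong (_* d) q≡0) (zeroˡ d))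
    where
    q≡0 : q ≡ 0#
    q≡0 = ∥x∥≡0⇒x≡0 q (ℕₚ.n<1⇒n≡0 (ℕₚ.*-cancelʳ-< (∥ d ∥) (∥ q ∥) 1
      (subst₂ ℕ._<_ (∣-quotient-∥∥ d∣x) (sym (ℕₚ.*-identityˡ ∥ d ∥)) x<d)))

  ∣-dec : ∀ d x → d ≢ 0# → Dec (d ∣ x)
  ∣-dec d x d≢0 = decide (division x d d≢0)
    where
    decide : (∃[ q ] ∥ x - q * d ∥ ℕ.< ∥ d ∥) → Dec (d ∣ x)
    decide (q , r<d) = fromRemainder (∥ x - q * d ∥ ℕ.≟ 0)
      where
      fromRemainder : Dec (∥ x - q * d ∥ ≡ 0) → Dec (d ∣ x)
      fromRemainder (yes r≡0) = yes (q , sym (x∙y⁻¹≈ε⇒x≈y x (q * d) (∥x∥≡0⇒x≡0 (x - q * d) r≡0)))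
      fromRemainder (no  r≢0) = no λ d∣x →
        r≢0 (cong ∥_∥ (∥x∥<∥d∥∧d∣x⇒x≡0 {d} r<d (d∣x∧d∣y⇒d∣x-y d∣x (x∣ʳyx d q))))

  -- Bézout's identity for g = gcd a b enters only through `generated`, which says that
  -- g lies in every ideal of the form { c : p ∣ c w } that contains a and b.
  record GCD (a b : 𝔼) : Set where
    field
      g         : 𝔼
      g∣a       : g ∣ a
      g∣b       : g ∣ b
      generated : ∀ {p} w → p ∣ a * w → p ∣ b * w → p ∣ g * w

  gcd : ∀ a b → GCD a b
  gcd a b = go a b (<-wellFounded ∥ b ∥)
    where
    step : ∀ {a b} q → GCD b (a - q * b) → GCD a b
    step {a} {b} q gcd-r = record
      { g         = g
      ; g∣a       = d∣x-y∧d∣y⇒d∣x a (q * b) g∣b (x∣ʳy⇒x∣ʳzy q g∣a)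
      ; g∣b       = g∣a
      ; generated = λ {p} w p∣aw p∣bw → generated w p∣bw
          (∣ʳ-respʳ-≈ (sym (trans ([y-z]x≈yx-zx w a (q * b)) (cong (λ z → a * w - z) (*-assoc q b w))))
            (d∣x∧d∣y⇒d∣x-y p∣aw (x∣ʳy⇒x∣ʳzy q p∣bw))) }
      where open GCD gcd-r

    go : ∀ a b → Acc ℕ._<_ ∥ b ∥ → GCD a b
    go a b (acc rs) = cases (∥ b ∥ ℕ.≟ 0)
      where
      cases : Dec (∥ b ∥ ≡ 0) → GCD a b
      cases (yes b≡0) = record
        { g         = a
        ; g∣a       = 1# , *-identityˡ a
        ; g∣b       = subst (a ∣_) (sym (∥x∥≡0⇒x≡0 b b≡0)) (a ∣0)
        ; generated = λ w p∣aw _ → p∣aw }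
      cases (no b≢0) = step (proj₁ quotient) (go b _ (rs (proj₂ quotient)))
        where quotient = division a b (b≢0 ∘ cong ∥_∥)

  -- Units are the elements of norm 1, so everything is phrased through norms: a divisor with the
  -- norm of π is an associate of π.
  record Irreducible (π : 𝔼) : Set where
    field
      nonunit : 1 ℕ.< ∥ π ∥
      minimal : ∀ {d} → d ∣ π → 1 ℕ.< ∥ d ∥ → ∥ d ∥ ≡ ∥ π ∥

    nonzero : π ≢ 0#
    nonzero π≡0 = contradiction (subst (λ z → 1 ℕ.< ∥ z ∥) π≡0 nonunit) λ ()

    ∤1 : π ∤ 1#
    ∤1 (q , qπ≡1) = ℕₚ.<⇒≢ nonunit (sym (ℕₚ.m*n≡1⇒n≡1 (∥ q ∥) (∥ π ∥) (trans (sym (∥∥-* q π)) (cong ∥_∥ qπ≡1))))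

    -- Let g be the gcd of π and x. If g is not a unit, it is an associate of π, and then π divides
    -- x. Otherwise the ideal of all c with π ∣ c y contains π and x, hence g, hence 1.
    euclidsLemma : ∀ {x y} → π ∣ x * y → π ∤ x → π ∣ y
    euclidsLemma {x} {y} π∣xy π∤x = cases (1 ℕ.<? ∥ g ∥)
      where
      open GCD (gcd π x)
      cases : Dec (1 ℕ.< ∥ g ∥) → π ∣ y
      cases (yes 1<g) = contradiction (∣ʳ-trans (∥d∥≡∥x∥∧d∣x⇒x∣d nonzero (minimal g∣a 1<g) g∣a) g∣b) π∤x
      cases (no  1≮g) = ∣ʳ-respʳ-≈ (begin
          conj g * (g * y)  ≡⟨ *-assoc (conj g) g y ⟨
          conj g * g * y    ≡⟨ cong (_* y) (∥u∥≡1⇒conj[u]*u≡1 g ∥g∥≡1) ⟩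
          1# * y            ≡⟨ *-identityˡ y ⟩
          y                 ∎)
        (x∣ʳy⇒x∣ʳzy (conj g) (generated y (x∣xy π y) π∣xy))
        where
        open ≡-Reasoning
        g≢0 : g ≢ 0#
        g≢0 g≡0 = nonzero (0∣x⇒x≈0 (subst (_∣ π) g≡0 g∣a))
        ∥g∥≡1 : ∥ g ∥ ≡ 1
        ∥g∥≡1 = ℕₚ.≤-antisym (ℕₚ.≮⇒≥ 1≮g) (x≢0⇒∥x∥>0 g g≢0)

    ∤-^ : ∀ {x} → π ∤ x → ∀ n → π ∤ x ^ n
    ∤-^ π∤x zero    π∣1   = ∤1 π∣1
    ∤-^ π∤x (suc n) π∣xxⁿ = ∤-^ π∤x n (euclidsLemma π∣xxⁿ π∤x)

    -- One factor at a time: Euclid's lemma extracts a π from y, which is then cancelled on both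
    -- sides.
    euclidsLemma-^ : ∀ {x} → π ∤ x → ∀ k {y} → π ^ k ∣ x * y → π ^ k ∣ y
    euclidsLemma-^ π∤x zero    {y} _ = y , trans (*-comm y 1#) (*-identityˡ y)
    euclidsLemma-^ {x} π∤x (suc k) {y} πᵏ⁺¹∣xy@(e , eππᵏ≡xy) = fromFactor (euclidsLemma (∣ʳ-trans (x∣xy π (π ^ k)) πᵏ⁺¹∣xy) π∤x)
      where
      open ≡-Reasoning
      fromFactor : π ∣ y → π ^ suc k ∣ y
      fromFactor (c , cπ≡y) = subst (π ^ suc k ∣_) (trans (*-comm π c) cπ≡y)
        (x∣y⇒zx∣zy π (euclidsLemma-^ π∤x k (e , *-cancelˡ π nonzero (begin
          π * (e * π ^ k)  ≡⟨ x∙yz≈y∙xz π e (π ^ k) ⟩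
          e * (π * π ^ k)  ≡⟨ eππᵏ≡xy ⟩
          x * y            ≡⟨ cong (x *_) (trans (sym cπ≡y) (*-comm c π)) ⟩
          x * (π * c)      ≡⟨ x∙yz≈y∙xz x π c ⟩
          π * (x * c)      ∎))))

  conj-irreducible : ∀ {π} → Irreducible π → Irreducible (conj π)
  conj-irreducible {π} irr = record
    { nonunit = subst (1 ℕ.<_) (sym (∥∥-conj π)) nonunit
    ; minimal = λ {d} d∣conj[π] 1<d → trans (sym (∥∥-conj d)) (trans
        (minimal (subst (conj d ∣_) (conj-involutive π) (conj-∣ d∣conj[π])) (subst (1 ℕ.<_) (sym (∥∥-conj d)) 1<d))
        (sym (∥∥-conj π))) }
    where open Irreducible irr

  -- The theorem is a negation, so the double negation spares a search for divisors.
  ∃-irreducibleDivisor : ∀ x → 1 ℕ.< ∥ x ∥ → ¬ ¬ (∃[ π ] Irreducible π × π ∣ x)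
  ∃-irreducibleDivisor x 1<x = go x 1<x (<-wellFounded ∥ x ∥)
    where
    go : ∀ x → 1 ℕ.< ∥ x ∥ → Acc ℕ._<_ ∥ x ∥ → ¬ ¬ (∃[ π ] Irreducible π × π ∣ x)
    -- The element x itself is offered as irreducible: a divisor of smaller norm above 1 would by
    -- induction have an irreducible divisor, which also divides x, against `none`.
    go x 1<x (acc rs) none = none (x , record { nonunit = 1<x ; minimal = minimal } , (1# , *-identityˡ x))
      where
      minimal : ∀ {d} → d ∣ x → 1 ℕ.< ∥ d ∥ → ∥ d ∥ ≡ ∥ x ∥
      minimal {d} d∣x@(q , qd≡x) 1<d = cases (∥ d ∥ ℕ.≟ ∥ x ∥)
        where
        instance
          ∥q∥≢0 : ℕ.NonZero ∥ q ∥
          ∥q∥≢0 = ℕ.≢-nonZero λ q≡0 → ℕₚ.n≮0 (subst (1 ℕ.<_) (trans (∣-quotient-∥∥ d∣x) (cong (ℕ._* ∥ d ∥) q≡0)) 1<x)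
        cases : Dec (∥ d ∥ ≡ ∥ x ∥) → ∥ d ∥ ≡ ∥ x ∥
        cases (yes eq)  = eq
        cases (no  neq) = contradiction (λ (π , irr , π∣d) → none (π , irr , ∣ʳ-trans π∣d d∣x))
          (go d 1<d (rs (ℕₚ.≤∧≢⇒< (subst (∥ d ∥ ℕ.≤_) (sym (∣-quotient-∥∥ d∣x)) (ℕₚ.m≤n*m (∥ d ∥) (∥ q ∥))) neq)))

  -- Shells and their sums of sixth powers.

  _≟_ : DecidableEquality 𝔼
  (a +ω b) ≟ (c +ω d) = map′ (λ (p , q) → cong₂ _+ω_ p q) (λ eq → cong re eq , cong im eq)
    ((a ℤ.≟ c) ×-dec (b ℤ.≟ d))

  record Shell (n : ℕ) : Set where
    field
      points   : List 𝔼
      unique   : Unique points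
      sound    : ∀ {x} → x ∈ points → ∥ x ∥ ≡ n
      complete : ∀ {x} → ∥ x ∥ ≡ n → x ∈ points

  open Shell

  Σ⁶ : List 𝔼 → 𝔼
  Σ⁶ = foldr (λ x s → x ^ 6 + s) 0#

  Σ⁶-++ : ∀ xs ys → Σ⁶ (xs ++ ys) ≡ Σ⁶ xs + Σ⁶ ys
  Σ⁶-++ []       ys = sym (+-identityˡ (Σ⁶ ys))
  Σ⁶-++ (x ∷ xs) ys = trans (cong (λ z → x ^ 6 + z) (Σ⁶-++ xs ys)) (sym (+-assoc (x ^ 6) (Σ⁶ xs) (Σ⁶ ys)))

  Σ⁶-map-* : ∀ c xs → Σ⁶ (map (c *_) xs) ≡ c ^ 6 * Σ⁶ xs
  Σ⁶-map-* c []       = sym (zeroʳ (c ^ 6))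
  Σ⁶-map-* c (x ∷ xs) = trans (cong₂ _+_ (^-distrib-* c x 6) (Σ⁶-map-* c xs)) (sym (distribˡ (c ^ 6) (x ^ 6) (Σ⁶ xs)))

  units : Shell 1
  units = record
    { points   = us
    ; unique   = from-yes (DecUnique.unique? _≟_ us)
    ; sound    = λ { (here refl) → refl
                   ; (there (here refl)) → refl
                   ; (there (there (here refl))) → refl
                   ; (there (there (there (here refl)))) → refl
                   ; (there (there (there (there (here refl))))) → refl
                   ; (there (there (there (there (there (here refl)))))) → refl }
    ; complete = λ {x} eq → cases x (bound (∣re∣≤∥∥ x) eq) (bound (∣im∣≤∥∥ x) eq) eq }
    where
    us : List 𝔼
    us = (1ℤ +ω 0ℤ) ∷ (0ℤ +ω 1ℤ) ∷ (ℤ.- 1ℤ +ω 1ℤ) ∷ (ℤ.- 1ℤ +ω 0ℤ) ∷ (0ℤ +ω ℤ.- 1ℤ) ∷ (1ℤ +ω ℤ.- 1ℤ) ∷ []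
    bound : ∀ {k n} → k ℕ.≤ n → n ≡ 1 → k ℕ.≤ 1
    bound k≤n refl = k≤n
    cases : ∀ x → ℤ.∣ re x ∣ ℕ.≤ 1 → ℤ.∣ im x ∣ ℕ.≤ 1 → ∥ x ∥ ≡ 1 → x ∈ us
    cases (+ 1      +ω + 0)      _ _ _ = here refl
    cases (+ 0      +ω + 1)      _ _ _ = there (here refl)
    cases (-[1+ 0 ] +ω + 1)      _ _ _ = there (there (here refl))
    cases (-[1+ 0 ] +ω + 0)      _ _ _ = there (there (there (here refl)))
    cases (+ 0      +ω -[1+ 0 ]) _ _ _ = there (there (there (there (here refl))))
    cases (+ 1      +ω -[1+ 0 ]) _ _ _ = there (there (there (there (there (here refl)))))
    cases (+ 0      +ω + 0)      _ _ ()
    cases (+ 1      +ω + 1)      _ _ ()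
    cases (-[1+ 0 ] +ω -[1+ 0 ]) _ _ ()
    cases (+ suc (suc _) +ω _)   (ℕ.s≤s ()) _ _
    cases (-[1+ suc _ ] +ω _)    (ℕ.s≤s ()) _ _
    cases (_ +ω + suc (suc _))   _ (ℕ.s≤s ()) _
    cases (_ +ω -[1+ suc _ ])    _ (ℕ.s≤s ()) _

  -- All points z of a shell share the product z z̄, so a divisor of one point carries over to the
  -- product of any other.
  ∥x∥≡∥y∥∧d∣x⇒d∣y*conj[y] : ∀ {d} x y → ∥ x ∥ ≡ ∥ y ∥ → d ∣ x → d ∣ y * conj y
  ∥x∥≡∥y∥∧d∣x⇒d∣y*conj[y] {d} x y eq d∣x = subst (d ∣_) (begin
    x * conj x   ≡⟨ x*conj[x]≡ι[norm] x ⟩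
    ι (norm x)   ≡⟨ cong ι (norm≡+∥∥ x) ⟩
    ι (+ ∥ x ∥)  ≡⟨ cong (ι ∘ +_) eq ⟩
    ι (+ ∥ y ∥)  ≡⟨ cong ι (norm≡+∥∥ y) ⟨
    ι (norm y)   ≡⟨ x*conj[x]≡ι[norm] y ⟨
    y * conj y   ∎) (∣ʳ-trans d∣x (x∣xy x (conj x)))
    where open ≡-Reasoning

  conj-∣⁻ : ∀ {d x} → conj d ∣ x → d ∣ conj x
  conj-∣⁻ {d} d̄∣x = subst (_∣ _) (conj-involutive d) (conj-∣ d̄∣x)

  ∣-conj : ∀ {d x} → d ∣ conj x → conj d ∣ x
  ∣-conj {d} {x} d∣x̄ = subst (conj d ∣_) (conj-involutive x) (conj-∣ d∣x̄)

  x≢0⇒conj[x]≢0 : ∀ {x} → x ≢ 0# → conj x ≢ 0#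
  x≢0⇒conj[x]≢0 {x} x≢0 eq = x≢0 (trans (sym (conj-involutive x)) (cong conj eq))

  NonvanishingShell : ℕ → Set
  NonvanishingShell n = Σ (Shell n) λ s → Σ⁶ (points s) ≢ 0#

  -- The sum evaluates to 6. For the exponents 1 to 5 the powers of the units would cancel.
  units-nonvanishing : NonvanishingShell 1
  units-nonvanishing = units , λ ()

  ∣-∥∥ : ∀ {d x} ((q , _) : d ∣ x) → ∥ x ∥ ≡ ∥ d ∥ ℕ.* ∥ q ∥
  ∣-∥∥ {d} d∣x@(q , _) = trans (∣-quotient-∥∥ d∣x) (ℕₚ.*-comm (∥ q ∥) (∥ d ∥))

  x^n≢0 : ∀ {x} n → x ≢ 0# → x ^ n ≢ 0#
  x^n≢0 zero    x≢0 ()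
  x^n≢0 {x} (suc n) x≢0 eq = Sum.[ x≢0 , x^n≢0 n x≢0 ]′ (x*y≡0⇒x≡0∨y≡0 x (x ^ n) eq)

  -- Reducing a shell by an irreducible divisor.

  module _ {π} (irr : Irreducible π) where
    open Irreducible irr

    private
      instance
        ∥π∥≢0 : ℕ.NonZero ∥ π ∥
        ∥π∥≢0 = ℕ.>-nonZero (x≢0⇒∥x∥>0 π nonzero)

    -- π is ramified or inert, so every point of norm ∥π∥ n is divisible by π.
    selfConjugate-step : π ∣ conj π → ∀ y → NonvanishingShell ∥ y ∥ → NonvanishingShell (∥ π ∥ ℕ.* ∥ y ∥)
    selfConjugate-step π∣π̄ y (s , Σ⁶≢0) = record
      { points   = map (π *_) (points s)
      ; unique   = map⁺ (*-cancelˡ π nonzero) (unique s)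
      ; sound    = λ x∈ → soundness (∈-map⁻ (π *_) x∈)
      ; complete = λ {x} eq → completeness eq (divides x eq)
      } , λ eq → Sum.[ x^n≢0 6 nonzero , Σ⁶≢0 ]′
        (x*y≡0⇒x≡0∨y≡0 (π ^ 6) (Σ⁶ (points s)) (trans (sym (Σ⁶-map-* π (points s))) eq))
      where
      soundness : ∀ {x} → (∃[ w ] w ∈ points s × x ≡ π * w) → ∥ x ∥ ≡ ∥ π ∥ ℕ.* ∥ y ∥
      soundness (w , w∈ , x≡πw) = trans (cong ∥_∥ x≡πw) (trans (∥∥-* π w) (cong (∥ π ∥ ℕ.*_) (sound s w∈)))

      divides : ∀ x → ∥ x ∥ ≡ ∥ π ∥ ℕ.* ∥ y ∥ → π ∣ x
      divides x eq = cases (∣-dec π x nonzero)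
        where
        cases : Dec (π ∣ x) → π ∣ x
        cases (yes π∣x) = π∣x
        -- The point `π * y` lies on the same shell, so π divides x x̄ and therefore x̄.
        -- Conjugating, π̄ divides x, and π divides π̄.
        cases (no  π∤x) = ∣ʳ-trans π∣π̄ (∣-conj (euclidsLemma
          (∥x∥≡∥y∥∧d∣x⇒d∣y*conj[y] (π * y) x (trans (∥∥-* π y) (sym eq)) (x∣xy π y)) π∤x))

      completeness : ∀ {x} → ∥ x ∥ ≡ ∥ π ∥ ℕ.* ∥ y ∥ → π ∣ x → x ∈ map (π *_) (points s)
      completeness {x} eq π∣x@(w , wπ≡x) = subst (_∈ _) (trans (*-comm π w) wπ≡x)
        (∈-map⁺ (π *_) (complete s (ℕₚ.*-cancelˡ-≡ (∥ w ∥) (∥ y ∥) (∥ π ∥) (trans (sym (∣-∥∥ π∣x)) eq))))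

    module Split (π∤π̄ : π ∤ conj π) where
      open Irreducible (conj-irreducible irr) using ()
        renaming (euclidsLemma to euclidsLemma-conj; ∤-^ to conj-∤-^; ∤1 to conj-∤1; nonzero to conj-nonzero)

      π̄∤π : conj π ∤ π
      π̄∤π = π∤π̄ ∘ conj-∣⁻

      -- The sum of π^6i π̄^6j over i + j = k.
      coefficient : ℕ → 𝔼
      coefficient zero    = 1#
      coefficient (suc k) = π ^ 6 * coefficient k + (conj π ^ suc k) ^ 6

      -- Indivisibility by π̄ is stronger than nonvanishing, and it is what the recursion preserves:
      -- the new summand is a multiple of π̄, and π⁶ is prime to π̄.
      π̄∤coefficient : ∀ k → conj π ∤ coefficient k
      π̄∤coefficient zero    = conj-∤1
      π̄∤coefficient (suc k) π̄∣ = π̄∤coefficient k (euclidsLemma-conj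
        (d∣x+y∧d∣y⇒d∣x (π ^ 6 * coefficient k) ((conj π ^ suc k) ^ 6) π̄∣
          (∣ʳ-trans (x∣xy (conj π) (conj π ^ k)) (x∣xy (conj π ^ suc k) ((conj π ^ suc k) ^ 5))))
        (conj-∤-^ π̄∤π 6))

      module _ (y : 𝔼) (π∤y : π ∤ y) (π∤ȳ : π ∤ conj y) (s₀ : Shell ∥ y ∥) where

        list : ℕ → List 𝔼
        list zero    = points s₀
        list (suc k) = map (π *_) (list k) ++ map ((conj π ^ suc k) *_) (points s₀)

        Σ⁶-list : ∀ k → Σ⁶ (list k) ≡ coefficient k * Σ⁶ (points s₀)
        Σ⁶-list zero    = sym (*-identityˡ _)
        Σ⁶-list (suc k) = begin
          Σ⁶ (list (suc k))                                   ≡⟨ Σ⁶-++ (map (π *_) (list k)) _ ⟩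
          Σ⁶ (map (π *_) (list k)) + Σ⁶ (map (ρ *_) (points s₀))
            ≡⟨ cong₂ _+_ (Σ⁶-map-* π (list k)) (Σ⁶-map-* ρ (points s₀)) ⟩
          π ^ 6 * Σ⁶ (list k) + ρ ^ 6 * σ                     ≡⟨ cong (λ z → π ^ 6 * z + ρ ^ 6 * σ) (Σ⁶-list k) ⟩
          π ^ 6 * (coefficient k * σ) + ρ ^ 6 * σ
            ≡⟨ cong (_+ (ρ ^ 6 * σ)) (*-assoc (π ^ 6) (coefficient k) σ) ⟨
          π ^ 6 * coefficient k * σ + ρ ^ 6 * σ               ≡⟨ distribʳ σ (π ^ 6 * coefficient k) (ρ ^ 6) ⟨
          coefficient (suc k) * σ                             ∎
          where
          open ≡-Reasoning
          ρ = conj π ^ suc k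
          σ = Σ⁶ (points s₀)

        -- If π divided w it would divide y ȳ, hence y or ȳ. This keeps the two halves of
        -- `list (suc k)` disjoint.
        π∤shell : ∀ w → ∥ w ∥ ≡ ∥ y ∥ → π ∤ w
        π∤shell w eq π∣w = π∤ȳ (euclidsLemma (∥x∥≡∥y∥∧d∣x⇒d∣y*conj[y] w y eq π∣w) π∤y)

        norm-list : ∀ k {x} → x ∈ list k → ∥ x ∥ ≡ ∥ π ∥ ℕ.^ k ℕ.* ∥ y ∥
        norm-list zero    x∈ = trans (sound s₀ x∈) (sym (ℕₚ.*-identityˡ _))
        norm-list (suc k) {x} x∈ = Sum.[ multiple-π ∘ ∈-map⁻ (π *_) , multiple-π̄ ∘ ∈-map⁻ _ ]′ (∈-++⁻ (map (π *_) (list k)) x∈)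
          where
          multiple-π : (∃[ w ] w ∈ list k × x ≡ π * w) → ∥ x ∥ ≡ ∥ π ∥ ℕ.^ suc k ℕ.* ∥ y ∥
          multiple-π (w , w∈ , x≡πw) = trans (cong ∥_∥ x≡πw) (trans (∥∥-* π w)
            (trans (cong (∥ π ∥ ℕ.*_) (norm-list k w∈)) (sym (ℕₚ.*-assoc (∥ π ∥) (∥ π ∥ ℕ.^ k) (∥ y ∥)))))
          multiple-π̄ : (∃[ w ] w ∈ points s₀ × x ≡ conj π ^ suc k * w) → ∥ x ∥ ≡ ∥ π ∥ ℕ.^ suc k ℕ.* ∥ y ∥
          multiple-π̄ (w , w∈ , x≡) = trans (cong ∥_∥ x≡) (trans (∥∥-* (conj π ^ suc k) w)
            (cong₂ ℕ._*_ (trans (∥∥-^ (conj π) (suc k)) (cong (ℕ._^ suc k) (∥∥-conj π))) (sound s₀ w∈)))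

        unique-list : ∀ k → Unique (list k)
        unique-list zero    = unique s₀
        unique-list (suc k) = ++⁺ (map⁺ (*-cancelˡ π nonzero) (unique-list k))
          (map⁺ (*-cancelˡ _ (x^n≢0 (suc k) conj-nonzero)) (unique s₀))
          λ (x∈₁ , x∈₂) → disjoint (∈-map⁻ (π *_) x∈₁) (∈-map⁻ _ x∈₂)
          where
          disjoint : ∀ {x} → (∃[ w ] w ∈ list k × x ≡ π * w) → ¬ (∃[ w ] w ∈ points s₀ × x ≡ conj π ^ suc k * w)
          disjoint (v , _ , x≡πv) (w , w∈ , x≡) = π∤shell w (sound s₀ w∈)
            (euclidsLemma (subst (π ∣_) (trans (sym x≡πv) x≡) (x∣xy π v)) (∤-^ π∤π̄ (suc k)))

        complete-list : ∀ k {x} → ∥ x ∥ ≡ ∥ π ∥ ℕ.^ k ℕ.* ∥ y ∥ → x ∈ list k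
        complete-list zero    eq = complete s₀ (trans eq (ℕₚ.*-identityˡ _))
        complete-list (suc k) {x} eq = cases (∣-dec π x nonzero)
          where
          cases : Dec (π ∣ x) → x ∈ list (suc k)
          cases (yes π∣x@(w , wπ≡x)) = ∈-++⁺ˡ (subst (_∈ _) (trans (*-comm π w) wπ≡x)
            (∈-map⁺ (π *_) (complete-list k (ℕₚ.*-cancelˡ-≡ (∥ w ∥) _ (∥ π ∥)
              (trans (sym (∣-∥∥ π∣x)) (trans eq (ℕₚ.*-assoc (∥ π ∥) (∥ π ∥ ℕ.^ k) (∥ y ∥))))))))
          -- The point `π ^ suc k * y` is on the shell, so this power divides x x̄. As π is prime to
          -- x, the whole power divides x̄, and its conjugate divides x.
          cases (no π∤x) = fromFactor (∣-conj-^ (euclidsLemma-^ π∤x (suc k)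
              (∥x∥≡∥y∥∧d∣x⇒d∣y*conj[y] (π ^ suc k * y) x
                (trans (∥∥-* (π ^ suc k) y) (trans (cong (ℕ._* ∥ y ∥) (∥∥-^ π (suc k))) (sym eq)))
                (x∣xy (π ^ suc k) y))))
            where
            ∣-conj-^ : π ^ suc k ∣ conj x → conj π ^ suc k ∣ x
            ∣-conj-^ πᵏ∣x̄ = subst (_∣ x) (conj-^ π (suc k)) (∣-conj πᵏ∣x̄)
            fromFactor : conj π ^ suc k ∣ x → x ∈ list (suc k)
            fromFactor ρ∣x@(w , wρ≡x) = ∈-++⁺ʳ (map (π *_) (list k)) (subst (_∈ _) (trans (*-comm _ w) wρ≡x)
              (∈-map⁺ ((conj π ^ suc k) *_) (complete s₀ (ℕₚ.*-cancelˡ-≡ (∥ w ∥) (∥ y ∥) (∥ π ∥ ℕ.^ suc k) {{ℕₚ.m^n≢0 (∥ π ∥) (suc k)}}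
                (trans (cong (ℕ._* ∥ w ∥) (sym (trans (∥∥-^ (conj π) (suc k)) (cong (ℕ._^ suc k) (∥∥-conj π)))))
                  (trans (sym (∣-∥∥ ρ∣x)) eq))))))

        shell : ∀ k → Shell (∥ π ∥ ℕ.^ k ℕ.* ∥ y ∥)
        shell k = record { points = list k ; unique = unique-list k ; sound = norm-list k ; complete = complete-list k }

      split-step : ∀ {y} → π ∤ y → π ∤ conj y → NonvanishingShell ∥ y ∥ → ∀ k → NonvanishingShell (∥ π ∥ ℕ.^ k ℕ.* ∥ y ∥)
      split-step {y} π∤y π∤ȳ (s , Σ⁶≢0) k = shell y π∤y π∤ȳ s k , λ eq → Sum.[
        (λ c≡0 → π̄∤coefficient k (subst (conj π ∣_) (sym c≡0) (conj π ∣0))) , Σ⁶≢0 ]′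
        (x*y≡0⇒x≡0∨y≡0 (coefficient k) (Σ⁶ (points s)) (trans (sym (Σ⁶-list y π∤y π∤ȳ s k)) eq))

    quotient≢0 : ∀ {x} ((q , _) : π ∣ x) → x ≢ 0# → q ≢ 0#
    quotient≢0 (q , qπ≡x) x≢0 q≡0 = x≢0 (trans (sym qπ≡x) (trans (cong (_* π) q≡0) (zeroˡ π)))

    ∥q∥<∥x∥ : ∀ {x} ((q , _) : π ∣ x) → x ≢ 0# → ∥ q ∥ ℕ.< ∥ x ∥
    ∥q∥<∥x∥ π∣x@(q , _) x≢0 = subst (∥ q ∥ ℕ.<_) (sym (∣-quotient-∥∥ π∣x))
      (ℕₚ.m<m*n (∥ q ∥) (∥ π ∥) {{ℕ.>-nonZero (x≢0⇒∥x∥>0 q (quotient≢0 π∣x x≢0))}} nonunit)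

    -- Only the norm of x is factored, and `part` is not asked to divide x. This permits replacing x
    -- by x̄ when it is x̄ that π divides.
    record PrimitivePart (x : 𝔼) : Set where
      field
        exponent : ℕ
        part     : 𝔼
        π∤part   : π ∤ part
        π∤conj   : π ∤ conj part
        ∥x∥≡     : ∥ x ∥ ≡ ∥ π ∥ ℕ.^ exponent ℕ.* ∥ part ∥

      ∥part∥≤∥x∥ : ∥ part ∥ ℕ.≤ ∥ x ∥
      ∥part∥≤∥x∥ = subst (∥ part ∥ ℕ.≤_) (sym ∥x∥≡)
        (ℕₚ.m≤n*m (∥ part ∥) (∥ π ∥ ℕ.^ exponent) {{ℕₚ.m^n≢0 (∥ π ∥) exponent}})

    primitivePart-step : ∀ {x x′} ((q , _) : π ∣ x′) → ∥ x′ ∥ ≡ ∥ x ∥ → PrimitivePart q → PrimitivePart x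
    primitivePart-step {x} {x′} π∣x′ ∥x′∥≡∥x∥ p = record
      { exponent = suc exponent ; part = part ; π∤part = π∤part ; π∤conj = π∤conj
      ; ∥x∥≡ = trans (sym ∥x′∥≡∥x∥) (trans (∣-∥∥ π∣x′) (trans (cong (∥ π ∥ ℕ.*_) ∥x∥≡)
          (sym (ℕₚ.*-assoc (∥ π ∥) (∥ π ∥ ℕ.^ exponent) (∥ part ∥))))) }
      where open PrimitivePart p

    primitivePart : ∀ x → x ≢ 0# → PrimitivePart x
    primitivePart x x≢0 = go x x≢0 (<-wellFounded ∥ x ∥)
      where
      go : ∀ x → x ≢ 0# → Acc ℕ._<_ ∥ x ∥ → PrimitivePart x
      go x x≢0 (acc rs) = cases (∣-dec π x nonzero) (∣-dec π (conj x) nonzero)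
        where
        cases : Dec (π ∣ x) → Dec (π ∣ conj x) → PrimitivePart x
        cases (yes π∣x@(q , _)) _ = primitivePart-step {x} π∣x refl (go q (quotient≢0 π∣x x≢0) (rs (∥q∥<∥x∥ π∣x x≢0)))
        cases (no _) (yes π∣x̄@(q , _)) = primitivePart-step π∣x̄ (∥∥-conj x)
          (go q (quotient≢0 π∣x̄ x̄≢0) (rs (subst (∥ q ∥ ℕ.<_) (∥∥-conj x) (∥q∥<∥x∥ π∣x̄ x̄≢0))))
          where x̄≢0 = x≢0⇒conj[x]≢0 x≢0
        cases (no π∤x) (no π∤x̄) = record
          { exponent = 0 ; part = x ; π∤part = π∤x ; π∤conj = π∤x̄ ; ∥x∥≡ = sym (ℕₚ.*-identityˡ ∥ x ∥) }

  -- The induction on the norm.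

  nonvanishing : ∀ x → x ≢ 0# → ¬ ¬ NonvanishingShell ∥ x ∥
  nonvanishing x x≢0 = go x x≢0 (<-wellFounded ∥ x ∥)
    where
    go : ∀ x → x ≢ 0# → Acc ℕ._<_ ∥ x ∥ → ¬ ¬ NonvanishingShell ∥ x ∥
    go x x≢0 (acc rs) none = cases (1 ℕ.<? ∥ x ∥)
      where
      cases : ¬ Dec (1 ℕ.< ∥ x ∥)
      cases (no  1≮x) = none (subst NonvanishingShell (ℕₚ.≤-antisym (x≢0⇒∥x∥>0 x x≢0) (ℕₚ.≮⇒≥ 1≮x)) units-nonvanishing)
      cases (yes 1<x) = ∃-irreducibleDivisor x 1<x reduce
        where
        reduce : ¬ (∃[ π ] Irreducible π × π ∣ x)
        reduce (π , irr , π∣x@(q , _)) = splitting (∣-dec π (conj π) (Irreducible.nonzero irr))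
          where
          q<x = ∥q∥<∥x∥ irr π∣x x≢0
          splitting : ¬ Dec (π ∣ conj π)
          splitting (yes π∣π̄) = go q (quotient≢0 irr π∣x x≢0) (rs q<x) λ shell →
            none (subst NonvanishingShell (sym (∣-∥∥ π∣x)) (selfConjugate-step irr π∣π̄ q shell))
          -- The primitive part is taken of the quotient `q`, whose norm is already below that of x;
          -- this gives the descent. `primitivePart-step` then restores the removed factor in the
          -- exponent.
          splitting (no  π∤π̄) = go part part≢0 (rs (ℕₚ.≤-<-trans (PrimitivePart.∥part∥≤∥x∥ q-part) q<x)) λ shell →
            none (subst NonvanishingShell (sym ∥x∥≡) (Split.split-step irr π∤π̄ π∤part π∤conj shell exponent))
            where
            q-part = primitivePart irr q (quotient≢0 irr π∣x x≢0)
            open PrimitivePart (primitivePart-step irr {x} π∣x refl q-part)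
            part≢0 : part ≢ 0#
            part≢0 eq = π∤part (subst (π ∣_) (sym eq) (π ∣0))

  -- From the sum of sixth powers to an integer.

  Σ⁶-↭ : ∀ {xs ys} → xs ↭ ys → Σ⁶ xs ≡ Σ⁶ ys
  Σ⁶-↭ ↭.refl         = refl
  Σ⁶-↭ (↭.prep x p)   = cong (λ z → x ^ 6 + z) (Σ⁶-↭ p)
  Σ⁶-↭ (↭.swap x y p) = trans (cong (λ z → x ^ 6 + (y ^ 6 + z)) (Σ⁶-↭ p)) (exchange (x ^ 6) (y ^ 6) _)
    where
    exchange : ∀ x y z → x + (y + z) ≡ y + (x + z)
    exchange x y z = trans (sym (+-assoc x y z)) (trans (cong (_+ z) (+-comm x y)) (+-assoc y x z))
  Σ⁶-↭ (↭.trans p q)  = trans (Σ⁶-↭ p) (Σ⁶-↭ q)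

  -- The sum thus depends on n alone. This carries nonvanishing over to the list that a design
  -- supplies, and shows that the sum is fixed by conjugation.
  Shell-unique : ∀ {n} (s t : Shell n) → points s ↭ points t
  Shell-unique s t = ∼bag⇒↭ (unique∧set⇒bag (unique s) (unique t)
    (mk⇔ (complete t ∘ sound s) (complete s ∘ sound t)))

  conjugate : ∀ {n} → Shell n → Shell n
  conjugate s = record
    { points   = map conj (points s)
    ; unique   = map⁺ (λ {x} {y} eq → trans (sym (conj-involutive x)) (trans (cong conj eq) (conj-involutive y))) (unique s)
    ; sound    = λ x∈ → soundness (∈-map⁻ conj x∈)
    ; complete = λ {x} eq → subst (_∈ _) (conj-involutive x) (∈-map⁺ conj {x = conj x} (complete s {conj x} (trans (∥∥-conj x) eq))) }
    where
    soundness : ∀ {x} → (∃[ w ] w ∈ points s × x ≡ conj w) → ∥ x ∥ ≡ _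
    soundness (w , w∈ , x≡w̄) = trans (cong ∥_∥ x≡w̄) (trans (∥∥-conj w) (sound s w∈))

  conj-+ : ∀ x y → conj (x + y) ≡ conj x + conj y
  conj-+ (a +ω b) (c +ω d) = cong₂ _+ω_ (identity a b c d) (ℤₚ.neg-distrib-+ b d)
    where
    identity : ∀ a b c d → a ℤ.+ c ℤ.+ (b ℤ.+ d) ≡ a ℤ.+ b ℤ.+ (c ℤ.+ d)
    identity = solve-∀

  Σ⁶-map-conj : ∀ xs → Σ⁶ (map conj xs) ≡ conj (Σ⁶ xs)
  Σ⁶-map-conj []       = refl
  Σ⁶-map-conj (x ∷ xs) = trans (cong₂ _+_ (sym (conj-^ x 6)) (Σ⁶-map-conj xs)) (sym (conj-+ (x ^ 6) (Σ⁶ xs)))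

  trace : 𝔼 → ℤ
  trace x = re x ℤ.+ (re x ℤ.+ im x)

  conj[x]≡x∧trace≡0⇒x≡0 : ∀ x → conj x ≡ x → trace x ≡ 0ℤ → x ≡ 0#
  conj[x]≡x∧trace≡0⇒x≡0 (a +ω b) x̄≡x tr≡0 = cong₂ _+ω_ a≡0 b≡0
    where
    i≡-i⇒i≡0 : ∀ i → ℤ.- i ≡ i → i ≡ 0ℤ
    i≡-i⇒i≡0 (+ 0) _ = refl
    b≡0 : b ≡ 0ℤ
    b≡0 = i≡-i⇒i≡0 b (cong im x̄≡x)
    i+[i+0]≡2*i : ∀ i → i ℤ.+ (i ℤ.+ 0ℤ) ≡ + 2 ℤ.* i
    i+[i+0]≡2*i = solve-∀
    a≡0 : a ≡ 0ℤ
    a≡0 = ℤₚ.*-cancelˡ-≡ (+ 2) a 0ℤ (trans (sym (i+[i+0]≡2*i a)) (trans (cong (λ z → a ℤ.+ (a ℤ.+ z)) (sym b≡0)) tr≡0))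

  -- A design controls only the trace, which is twice the real part; for a sum fixed by conjugation
  -- that is enough.
  Σ⁶≡0 : ∀ {n} (s : Shell n) → trace (Σ⁶ (points s)) ≡ 0ℤ → Σ⁶ (points s) ≡ 0#
  Σ⁶≡0 s = conj[x]≡x∧trace≡0⇒x≡0 (Σ⁶ (points s))
    (trans (sym (Σ⁶-map-conj (points s))) (Σ⁶-↭ (Shell-unique (conjugate s) s)))

  -- The sixth Dickson polynomial: trace (x⁶) in terms of t = trace x and n = norm x.
  dickson₆ : ℤ → ℤ → ℤ
  dickson₆ t n = u ℤ.* u ℤ.- + 2 ℤ.* (n ℤ.* (n ℤ.* n))
    where u = t ℤ.* (t ℤ.* t) ℤ.- + 3 ℤ.* (n ℤ.* t)

  -- Square of a cube: tr(y²) = tr(y)² - 2 N(y) at y = x³, together with tr(x³) = t³ - 3nt. The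
  -- identities in coordinates then have degree at most three.
  trace-^6 : ∀ x → trace (x ^ 6) ≡ dickson₆ (trace x) (norm x)
  trace-^6 x@(a +ω b) = begin
    trace (x ^ 6)                                  ≡⟨ cong trace (^-homo-* x 3 3) ⟩
    trace (x ^ 3 * x ^ 3)                          ≡⟨ square (re (x ^ 3)) (im (x ^ 3)) ⟩
    trace (x ^ 3) ℤ.* trace (x ^ 3) ℤ.- + 2 ℤ.* norm (x ^ 3)
      ≡⟨ cong (λ y → trace y ℤ.* trace y ℤ.- + 2 ℤ.* norm y) (cong (λ z → x * (x * z)) (*-identityʳ x)) ⟩
    trace (x * (x * x)) ℤ.* trace (x * (x * x)) ℤ.- + 2 ℤ.* norm (x * (x * x))
      ≡⟨ cong₂ (λ u v → u ℤ.* u ℤ.- + 2 ℤ.* v) (trace-cube a b) (trans (norm-* x (x * x)) (cong (norm x ℤ.*_) (norm-* x x))) ⟩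
    dickson₆ (trace x) (norm x)                    ∎
    where
    open ≡-Reasoning
    square : ∀ c d → let e = c ℤ.* c ℤ.- d ℤ.* d; f = c ℤ.* d ℤ.+ d ℤ.* c ℤ.+ d ℤ.* d in
      e ℤ.+ (e ℤ.+ f) ≡ (c ℤ.+ (c ℤ.+ d)) ℤ.* (c ℤ.+ (c ℤ.+ d)) ℤ.- + 2 ℤ.* (c ℤ.* c ℤ.+ c ℤ.* d ℤ.+ d ℤ.* d)
    square = solve-∀
    trace-cube : ∀ a b → let c = a ℤ.* a ℤ.- b ℤ.* b; d = a ℤ.* b ℤ.+ b ℤ.* a ℤ.+ b ℤ.* b
                             e = a ℤ.* c ℤ.- b ℤ.* d; f = a ℤ.* d ℤ.+ b ℤ.* c ℤ.+ b ℤ.* d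
                             t = a ℤ.+ (a ℤ.+ b) in
      e ℤ.+ (e ℤ.+ f) ≡ t ℤ.* (t ℤ.* t) ℤ.- + 3 ℤ.* ((a ℤ.* a ℤ.+ a ℤ.* b ℤ.+ b ℤ.* b) ℤ.* t)
    trace-cube = solve-∀

  trace-+ : ∀ x y → trace (x + y) ≡ trace x ℤ.+ trace y
  trace-+ (a +ω b) (c +ω d) = identity a b c d
    where
    identity : ∀ a b c d → a ℤ.+ c ℤ.+ (a ℤ.+ c ℤ.+ (b ℤ.+ d)) ≡ a ℤ.+ (a ℤ.+ b) ℤ.+ (c ℤ.+ (c ℤ.+ d))
    identity = solve-∀

  dicksonSum : List 𝔼 → ℤ
  dicksonSum = foldr (λ x s → dickson₆ (trace x) (norm x) ℤ.+ s) 0ℤ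

  trace-Σ⁶ : ∀ xs → trace (Σ⁶ xs) ≡ dicksonSum xs
  trace-Σ⁶ []       = refl
  trace-Σ⁶ (x ∷ xs) = trans (trace-+ (x ^ 6) (Σ⁶ xs)) (cong₂ ℤ._+_ (trace-^6 x) (trace-Σ⁶ xs))

  -- The form in which the arithmetic meets the analysis: the design will force this same integer to
  -- be zero.
  dicksonSum≢0 : ∀ x → x ≢ 0# → (s : Shell ∥ x ∥) → dicksonSum (points s) ≢ 0ℤ
  dicksonSum≢0 x x≢0 s eq = nonvanishing x x≢0 λ (t , Σ⁶≢0) →
    Σ⁶≢0 (trans (Σ⁶-↭ (Shell-unique t s)) (Σ⁶≡0 s (trans (trace-Σ⁶ (points s)) eq)))

-- Arithmetic of Cauchy reals.

open import Algebra.Properties.Group ℚₚ.+-0-group using (x∙y⁻¹≈ε⇒x≈y)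
open import Defs
open EisensteinIntegers
  using (𝔼; _+ω_; norm; ∥_∥; norm≡+∥∥; ∥x∥≡0⇒x≡0; trace; dickson₆; dicksonSum; dicksonSum≢0; Shell)
open +-*-Solver using (solve; con; _:+_; _:*_; _:-_; :-_; _:=_)

-- Operations on `ℝ` are termwise, so a ring identity between reals reduces to one over ℚ, within
-- reach of the solver.
≗⇒≈ : ∀ {x y} → (∀ n → seq x n ≡ seq y n) → x ≈ y
≗⇒≈ {x} {y} eq = mk≈ λ ε 0<ε → 0 , λ n _ →
  subst (λ z → ∣ z ∣ ℚ.≤ ε) (sym (trans (cong (ℚ._- seq y n) (eq n)) (ℚₚ.+-inverseʳ (seq y n)))) (ℚₚ.<⇒≤ 0<ε)

≈-refl : ∀ {x} → x ≈ x
≈-refl = ≗⇒≈ λ _ → refl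

≈-sym : ∀ {x y} → x ≈ y → y ≈ x
≈-sym {x} {y} (mk≈ x≈y) = mk≈ λ ε 0<ε → let N , close = x≈y ε 0<ε in
  N , λ n N≤n → subst (ℚ._≤ ε) (∣-∣-sym (seq x n) (seq y n)) (close n N≤n)

≈-trans : ∀ {x y z} → x ≈ y → y ≈ z → x ≈ z
≈-trans {x} {y} {z} (mk≈ x≈y) (mk≈ y≈z) = mk≈ λ ε 0<ε →
  let M , xy = x≈y (½ ℚ.* ε) (0<* 0<½ 0<ε)
      N , yz = y≈z (½ ℚ.* ε) (0<* 0<½ 0<ε)
  in M ℕ.⊔ N , λ n ≤n → begin
    ∣ seq x n - seq z n ∣                            ≤⟨ triangle (seq x n) (seq y n) (seq z n) ⟩
    ∣ seq x n - seq y n ∣ ℚ.+ ∣ seq y n - seq z n ∣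
      ≤⟨ ℚₚ.+-mono-≤ (xy n (ℕₚ.m⊔n≤o⇒m≤o M N ≤n)) (yz n (ℕₚ.m⊔n≤o⇒n≤o M N ≤n)) ⟩
    ½ ℚ.* ε ℚ.+ ½ ℚ.* ε                              ≡⟨ ½+½ ε ⟩
    ε                                                ∎
  where open ℚₚ.≤-Reasoning

ℝ-setoid : Setoid _ _
ℝ-setoid = record
  { Carrier = ℝ ; _≈_ = _≈_ ; isEquivalence = record { refl = ≈-refl ; sym = ≈-sym ; trans = ≈-trans } }

+-cong : ∀ {x x′ y y′} → x ≈ x′ → y ≈ y′ → x + y ≈ x′ + y′
+-cong {x} {x′} {y} {y′} (mk≈ x≈x′) (mk≈ y≈y′) = mk≈ λ ε 0<ε →
  let M , xx = x≈x′ (½ ℚ.* ε) (0<* 0<½ 0<ε)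
      N , yy = y≈y′ (½ ℚ.* ε) (0<* 0<½ 0<ε)
  in M ℕ.⊔ N , λ n ≤n → begin
    ∣ seq x n ℚ.+ seq y n - (seq x′ n ℚ.+ seq y′ n) ∣
      ≡⟨ cong ∣_∣ (solve 4 (λ a b c d → (a :+ b) :- (c :+ d) := (a :- c) :+ (b :- d)) refl (seq x n) (seq y n) (seq x′ n) (seq y′ n)) ⟩
    ∣ (seq x n ℚ.- seq x′ n) ℚ.+ (seq y n ℚ.- seq y′ n) ∣
      ≤⟨ ℚₚ.∣p+q∣≤∣p∣+∣q∣ (seq x n ℚ.- seq x′ n) (seq y n ℚ.- seq y′ n) ⟩
    ∣ seq x n - seq x′ n ∣ ℚ.+ ∣ seq y n - seq y′ n ∣
      ≤⟨ ℚₚ.+-mono-≤ (xx n (ℕₚ.m⊔n≤o⇒m≤o M N ≤n)) (yy n (ℕₚ.m⊔n≤o⇒n≤o M N ≤n)) ⟩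
    ½ ℚ.* ε ℚ.+ ½ ℚ.* ε
      ≡⟨ ½+½ ε ⟩
    ε ∎
  where open ℚₚ.≤-Reasoning

*-cong : ∀ {x x′ y y′} → x ≈ x′ → y ≈ y′ → x * y ≈ x′ * y′
*-cong {x} {x′} {y} {y′} (mk≈ x≈x′) (mk≈ y≈y′) = mk≈ λ ε 0<ε →
  let A , 0<A , L , ∣x∣≤A  = eventuallyBounded {seq x} (cauchy x)
      B , 0<B , M , ∣y′∣≤B = eventuallyBounded {seq y′} (cauchy y′)
      δ , 0<δ , Aδ = divide {A} {ε} 0<A 0<ε
      η , 0<η , Bη = divide {B} {ε} 0<B 0<ε
      Y , y-close = y≈y′ δ 0<δ
      X , x-close = x≈x′ η 0<η
  in (L ℕ.⊔ M) ℕ.⊔ (X ℕ.⊔ Y) , λ n ≤n →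
    let LM≤n = ℕₚ.m⊔n≤o⇒m≤o (L ℕ.⊔ M) (X ℕ.⊔ Y) ≤n
        XY≤n = ℕₚ.m⊔n≤o⇒n≤o (L ℕ.⊔ M) (X ℕ.⊔ Y) ≤n
    in ∣product-product∣≤ {seq x n} {seq y n} {seq x′ n} {seq y′ n} {A} {B} {δ} {η} {ε} (ℚₚ.<⇒≤ 0<A) (ℚₚ.<⇒≤ 0<B) Aδ Bη
      (∣x∣≤A n (ℕₚ.m⊔n≤o⇒m≤o L M LM≤n)) (∣y′∣≤B n (ℕₚ.m⊔n≤o⇒n≤o L M LM≤n))
      (y-close n (ℕₚ.m⊔n≤o⇒n≤o X Y XY≤n)) (x-close n (ℕₚ.m⊔n≤o⇒m≤o X Y XY≤n))

p≰½p : ∀ {p} → 0ℚ ℚ.< p → ¬ p ℚ.≤ ½ ℚ.* p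
p≰½p {p} 0<p p≤½p = ℚₚ.<-irrefl refl (begin-strict
  ½ ℚ.* p               ≡⟨ ℚₚ.+-identityʳ (½ ℚ.* p) ⟨
  ½ ℚ.* p ℚ.+ 0ℚ        <⟨ ℚₚ.+-monoʳ-< (½ ℚ.* p) (0<* 0<½ 0<p) ⟩
  ½ ℚ.* p ℚ.+ ½ ℚ.* p   ≡⟨ ½+½ p ⟩
  p                     ≤⟨ p≤½p ⟩
  ½ ℚ.* p               ∎)
  where open ℚₚ.≤-Reasoning

∣p∣≤ε⇒p≡0 : ∀ p → (∀ ε → 0ℚ ℚ.< ε → ∣ p ∣ ℚ.≤ ε) → p ≡ 0ℚ
∣p∣≤ε⇒p≡0 p small = ℚₚ.∣p∣≡0⇒p≡0 p (ℚₚ.≤-antisym ∣p∣≤0 (ℚₚ.0≤∣p∣ p))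
  where
  ∣p∣≤0 : ∣ p ∣ ℚ.≤ 0ℚ
  ∣p∣≤0 = ℚₚ.≮⇒≥ λ 0<∣p∣ → p≰½p 0<∣p∣ (small (½ ℚ.* ∣ p ∣) (0<* 0<½ 0<∣p∣))

fromℚ-injective : ∀ {p q} → fromℚ p ≈ fromℚ q → p ≡ q
fromℚ-injective {p} {q} (mk≈ p≈q) = x∙y⁻¹≈ε⇒x≈y p q (∣p∣≤ε⇒p≡0 (p ℚ.- q) λ ε 0<ε → let N , close = p≈q ε 0<ε in close N ℕₚ.≤-refl)

x<y⇒x≉y : ∀ {x y} → x < y → ¬ x ≈ y
x<y⇒x≉y {x} {y} (mk< gap 0<gap (M , x+gap≤y)) (mk≈ x≈y) =
  let N , close = x≈y (½ ℚ.* gap) (0<* 0<½ 0<gap)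
      n = M ℕ.⊔ N
  in p≰½p 0<gap (begin
    gap                                  ≡⟨ solve 2 (λ a g → g := (a :+ g) :- a) refl (seq x n) gap ⟩
    seq x n ℚ.+ gap ℚ.- seq x n          ≤⟨ ℚₚ.+-monoˡ-≤ (ℚ.- seq x n) (x+gap≤y n (ℕₚ.m≤m⊔n M N)) ⟩
    seq y n ℚ.- seq x n                  ≤⟨ p≤∣p∣ (seq y n ℚ.- seq x n) ⟩
    ∣ seq y n - seq x n ∣                ≡⟨ ∣-∣-sym (seq y n) (seq x n) ⟩
    ∣ seq x n - seq y n ∣                ≤⟨ close n (ℕₚ.m≤n⊔m M N) ⟩
    ½ ℚ.* gap                            ∎)
  where
  open ℚₚ.≤-Reasoning
  p≤∣p∣ : ∀ p → p ℚ.≤ ∣ p ∣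
  p≤∣p∣ p with ℚₚ.≤-total 0ℚ p
  ... | inj₁ 0≤p = ℚₚ.≤-reflexive (sym (ℚₚ.0≤p⇒∣p∣≡p 0≤p))
  ... | inj₂ p≤0 = ℚₚ.≤-trans p≤0 (ℚₚ.0≤∣p∣ p)

-- The integers inside the rationals.

ι : ℤ → ℚ
ι i = i ℚ./ 1

toℚᵘ-ι : ∀ i → ℚ.toℚᵘ (ι i) ℚᵘ.≃ ℚᵘ.mkℚᵘ i 0
toℚᵘ-ι i = ℚₚ.toℚᵘ-fromℚᵘ (ℚᵘ.mkℚᵘ i 0)

ι-+ : ∀ i j → ι (i ℤ.+ j) ≡ ι i ℚ.+ ι j
ι-+ i j = ℚₚ.toℚᵘ-injective (ℚᵘₚ.≃-trans (toℚᵘ-ι (i ℤ.+ j)) (ℚᵘₚ.≃-sym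
  (ℚᵘₚ.≃-trans (ℚₚ.toℚᵘ-homo-+ (ι i) (ι j)) (ℚᵘₚ.≃-trans (ℚᵘₚ.+-cong (toℚᵘ-ι i) (toℚᵘ-ι j)) (ℚᵘ.*≡* (identity i j))))))
  where
  identity : ∀ i j → (i ℤ.* + 1 ℤ.+ j ℤ.* + 1) ℤ.* + 1 ≡ (i ℤ.+ j) ℤ.* (+ 1 ℤ.* + 1)
  identity = solve-∀

ι-* : ∀ i j → ι (i ℤ.* j) ≡ ι i ℚ.* ι j
ι-* i j = ℚₚ.toℚᵘ-injective (ℚᵘₚ.≃-trans (toℚᵘ-ι (i ℤ.* j)) (ℚᵘₚ.≃-sym
  (ℚᵘₚ.≃-trans (ℚₚ.toℚᵘ-homo-* (ι i) (ι j)) (ℚᵘₚ.≃-trans (ℚᵘₚ.*-cong (toℚᵘ-ι i) (toℚᵘ-ι j)) (ℚᵘ.*≡* (identity i j))))))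
  where
  identity : ∀ i j → (i ℤ.* j) ℤ.* + 1 ≡ (i ℤ.* j) ℤ.* (+ 1 ℤ.* + 1)
  identity = solve-∀

ι-neg : ∀ i → ι (ℤ.- i) ≡ ℚ.- ι i
ι-neg i = begin
  ι (ℤ.- i)              ≡⟨ cong ι (ℤₚ.-1*i≡-i i) ⟨
  ι (ℤ.-1ℤ ℤ.* i)        ≡⟨ ι-* ℤ.-1ℤ i ⟩
  ι ℤ.-1ℤ ℚ.* ι i        ≡⟨ solve 1 (λ x → con (ι ℤ.-1ℤ) :* x := :- x) refl (ι i) ⟩
  ℚ.- ι i                ∎
  where open ≡-Reasoning

ι-injective : ∀ {i j} → ι i ≡ ι j → i ≡ j
ι-injective {i} {j} eq = trans (sym (ℤₚ.*-identityʳ i)) (trans (numerators (ℚᵘₚ.≃-trans (ℚᵘₚ.≃-sym (toℚᵘ-ι i))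
    (ℚᵘₚ.≃-trans (ℚᵘₚ.≃-reflexive (cong ℚ.toℚᵘ eq)) (toℚᵘ-ι j)))) (ℤₚ.*-identityʳ j))
  where
  numerators : ℚᵘ.mkℚᵘ i 0 ℚᵘ.≃ ℚᵘ.mkℚᵘ j 0 → i ℤ.* + 1 ≡ j ℤ.* + 1
  numerators (ℚᵘ.*≡* p) = p

-- The square of √3.

if-does : ∀ {P A : Set} (P? : Dec P) {a b : A} →
          P × (if does P? then a else b) ≡ a ⊎ ¬ P × (if does P? then a else b) ≡ b
if-does (yes p) = inj₁ (p , refl)
if-does (no ¬p) = inj₂ (¬p , refl)

-- The invariant of the bisection: the root lies in [s, s + ½ⁿ].
record √3-Bounds (n : ℕ) (s : ℚ) : Set where
  constructor bounds
  field
    0≤s      : 0ℚ ℚ.≤ s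
    s²≤3     : s ℚ.* s ℚ.≤ 3ℚ
    3≤[s+h]² : 3ℚ ℚ.≤ (s ℚ.+ ½^ n) ℚ.* (s ℚ.+ ½^ n)

√3-bounds : ∀ n → √3-Bounds n (√3-seq n)
√3-bounds zero    = bounds 0≤1 (ℚ.*≤* (ℤ.+≤+ (ℕ.s≤s ℕ.z≤n))) (ℚ.*≤* (ℤ.+≤+ (ℕ.s≤s (ℕ.s≤s (ℕ.s≤s ℕ.z≤n)))))
√3-bounds (suc n) = Sum.[
    (λ (next²≤3 , eq) → subst (√3-Bounds (suc n)) (sym eq) (bounds
      (0≤+ {√3-seq n} {½^ suc n} 0≤s (0≤½^ (suc n)))
      next²≤3
      (subst (λ z → 3ℚ ℚ.≤ z ℚ.* z) (halves (√3-seq n) (½^ n)) 3≤[s+h]²)))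
  , (λ (next²≰3 , eq) → subst (√3-Bounds (suc n)) (sym eq) (bounds 0≤s s²≤3 (ℚₚ.<⇒≤ (ℚₚ.≰⇒> next²≰3))))
  ]′ (if-does (next ℚ.* next ℚₚ.≤? 3ℚ))
  where
  open √3-Bounds (√3-bounds n)
  next = √3-seq n ℚ.+ ½^ suc n
  halves : ∀ s h → s ℚ.+ h ≡ s ℚ.+ ½ ℚ.* h ℚ.+ ½ ℚ.* h
  halves = solve 2 (λ s h → s :+ h := s :+ con ½ :* h :+ con ½ :* h) refl

p²≤3⇒p≤2 : ∀ {p} → 0ℚ ℚ.≤ p → p ℚ.* p ℚ.≤ 3ℚ → p ℚ.≤ 2ℚ
p²≤3⇒p≤2 {p} 0≤p p²≤3 with ℚₚ.≤-total p 2ℚ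
... | inj₁ p≤2 = p≤2
... | inj₂ 2≤p = contradiction (ℚₚ.≤-trans (*-mono-≤ 0≤2 0≤p 2≤p 2≤p) p²≤3) λ { (ℚ.*≤* (ℤ.+≤+ (ℕ.s≤s (ℕ.s≤s (ℕ.s≤s ()))))) }

√3²≈3 : √3 * √3 ≈ fromℚ 3ℚ
√3²≈3 = mk≈ λ ε 0<ε → let N , 5½ᴺ≤ε = archimedean 5ℚ 0<ε in
  N , λ n N≤n → ℚₚ.≤-trans (error n) (ℚₚ.≤-trans (ℚₚ.*-monoˡ-≤-nonNeg 5ℚ (½^-antimono N≤n)) 5½ᴺ≤ε)
  where
  open ℚₚ.≤-Reasoning
  -- From 3 - s² ≤ (s + h)² - s² = (2s + h) h with s ≤ 2 and h ≤ 1.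
  5ℚ = + 5 ℚ./ 1
  error : ∀ n → ∣ √3-seq n ℚ.* √3-seq n - 3ℚ ∣ ℚ.≤ 5ℚ ℚ.* ½^ n
  error n = begin
    ∣ s ℚ.* s - 3ℚ ∣                       ≡⟨ ∣-∣-sym (s ℚ.* s) 3ℚ ⟩
    ∣ 3ℚ - s ℚ.* s ∣
      ≡⟨ ℚₚ.0≤p⇒∣p∣≡p (subst (ℚ._≤ 3ℚ ℚ.- s ℚ.* s) (ℚₚ.+-inverseʳ (s ℚ.* s)) (ℚₚ.+-monoˡ-≤ (ℚ.- (s ℚ.* s)) s²≤3)) ⟩
    3ℚ ℚ.- s ℚ.* s                         ≤⟨ ℚₚ.+-monoˡ-≤ (ℚ.- (s ℚ.* s)) 3≤[s+h]² ⟩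
    (s ℚ.+ h) ℚ.* (s ℚ.+ h) ℚ.- s ℚ.* s
      ≡⟨ solve 2 (λ s h → (s :+ h) :* (s :+ h) :- s :* s := (s :+ s :+ h) :* h) refl s h ⟩
    (s ℚ.+ s ℚ.+ h) ℚ.* h
      ≤⟨ ℚₚ.*-monoʳ-≤-nonNeg h {{nonNegative (0≤½^ n)}} (ℚₚ.+-mono-≤ (ℚₚ.+-mono-≤ s≤2 s≤2) (½^≤1 n)) ⟩
    5ℚ ℚ.* h                               ∎
    where
    open √3-Bounds (√3-bounds n)
    s = √3-seq n
    h = ½^ n
    s≤2 = p²≤3⇒p≤2 0≤s s²≤3
  ½^-step : ∀ n → ½^ suc n ℚ.≤ ½^ n
  ½^-step n = begin
    ½ ℚ.* ½^ n    ≤⟨ ℚₚ.*-monoʳ-≤-nonNeg (½^ n) {{nonNegative (0≤½^ n)}} (½^≤1 1) ⟩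
    1ℚ ℚ.* ½^ n   ≡⟨ ℚₚ.*-identityˡ (½^ n) ⟩
    ½^ n          ∎
  ½^-antimono : ∀ {m n} → m ℕ.≤ n → ½^ n ℚ.≤ ½^ m
  ½^-antimono {m} m≤n with ℕₚ.≤⇒≤′ m≤n
  ... | ℕ.≤′-refl        = ℚₚ.≤-refl
  ... | ℕ.≤′-step {n} m≤′n = ℚₚ.≤-trans (½^-step n) (½^-antimono (ℕₚ.≤′⇒≤ m≤′n))

-- Riemann sums and the length of the circle.

riemannSum-cong : ∀ {f g} → (∀ t → f t ≡ g t) → ∀ n a h → riemannSum f a h n ≡ riemannSum g a h n
riemannSum-cong eq zero    a h = cong (h ℚ.*_) (eq (a ℚ.+ h))
riemannSum-cong eq (suc n) a h = cong₂ ℚ._+_ (riemannSum-cong eq n a _) (riemannSum-cong eq n _ _)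

riemannSum-* : ∀ c g n a h → riemannSum (λ t → c ℚ.* g t) a h n ≡ c ℚ.* riemannSum g a h n
riemannSum-* c g zero    a h = solve 3 (λ h c y → h :* (c :* y) := c :* (h :* y)) refl h c (g (a ℚ.+ h))
riemannSum-* c g (suc n) a h = trans (cong₂ ℚ._+_ (riemannSum-* c g n a _) (riemannSum-* c g n _ _))
  (sym (ℚₚ.*-distribˡ-+ c (riemannSum g a (½ ℚ.* h) n) (riemannSum g (a ℚ.+ ½ ℚ.* h) (½ ℚ.* h) n)))

riemannSum-+ : ∀ f g n a h → riemannSum (λ t → f t ℚ.+ g t) a h n ≡ riemannSum f a h n ℚ.+ riemannSum g a h n
riemannSum-+ f g zero    a h = ℚₚ.*-distribˡ-+ h (f (a ℚ.+ h)) (g (a ℚ.+ h))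
riemannSum-+ f g (suc n) a h = trans (cong₂ ℚ._+_ (riemannSum-+ f g n a k) (riemannSum-+ f g n (a ℚ.+ k) k))
  (solve 4 (λ p q r s → p :+ q :+ (r :+ s) := p :+ r :+ (q :+ s)) refl
    (riemannSum f a k n) (riemannSum g a k n) (riemannSum f (a ℚ.+ k) k n) (riemannSum g (a ℚ.+ k) k n))
  where k = ½ ℚ.* h

riemannSum-0 : ∀ n a h → riemannSum (λ _ → 0ℚ) a h n ≡ 0ℚ
riemannSum-0 zero    a h = ℚₚ.*-zeroʳ h
riemannSum-0 (suc n) a h = cong₂ ℚ._+_ (riemannSum-0 n a _) (riemannSum-0 n _ _)

1≤g⇒h≤riemannSum : ∀ g → (∀ t → 0ℚ ℚ.≤ t → t ℚ.≤ 1ℚ → 1ℚ ℚ.≤ g t) →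
  ∀ n a h → 0ℚ ℚ.≤ a → 0ℚ ℚ.≤ h → a ℚ.+ h ℚ.≤ 1ℚ → h ℚ.≤ riemannSum g a h n
1≤g⇒h≤riemannSum g 1≤g zero    a h 0≤a 0≤h a+h≤1 = begin
  h                  ≡⟨ ℚₚ.*-identityʳ h ⟨
  h ℚ.* 1ℚ           ≤⟨ ℚₚ.*-monoˡ-≤-nonNeg h {{nonNegative 0≤h}} (1≤g (a ℚ.+ h) (0≤+ {a} {h} 0≤a 0≤h) a+h≤1) ⟩
  h ℚ.* g (a ℚ.+ h)  ∎
  where open ℚₚ.≤-Reasoning
1≤g⇒h≤riemannSum g 1≤g (suc n) a h 0≤a 0≤h a+h≤1 = begin
  h        ≡⟨ ½+½ h ⟨
  k ℚ.+ k  ≤⟨ ℚₚ.+-mono-≤ (1≤g⇒h≤riemannSum g 1≤g n a k 0≤a 0≤k a+k≤1)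
                (1≤g⇒h≤riemannSum g 1≤g n (a ℚ.+ k) k (0≤+ {a} {k} 0≤a 0≤k) 0≤k (ℚₚ.≤-trans (ℚₚ.≤-reflexive a+k+k≡a+h) a+h≤1)) ⟩
  riemannSum g a h (suc n) ∎
  where
  open ℚₚ.≤-Reasoning
  k = ½ ℚ.* h
  0≤k : 0ℚ ℚ.≤ k
  0≤k = 0≤* {½} {h} 0≤½ 0≤h
  a+k+k≡a+h : a ℚ.+ k ℚ.+ k ≡ a ℚ.+ h
  a+k+k≡a+h = solve 2 (λ a h → a :+ con ½ :* h :+ con ½ :* h := a :+ h) refl a h
  a+k≤1 : a ℚ.+ k ℚ.≤ 1ℚ
  a+k≤1 = begin
    a ℚ.+ k            ≡⟨ ℚₚ.+-identityʳ (a ℚ.+ k) ⟨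
    a ℚ.+ k ℚ.+ 0ℚ     ≤⟨ ℚₚ.+-monoʳ-≤ (a ℚ.+ k) 0≤k ⟩
    a ℚ.+ k ℚ.+ k      ≡⟨ a+k+k≡a+h ⟩
    a ℚ.+ h            ≤⟨ a+h≤1 ⟩
    1ℚ                 ∎

-- The integrand is 8 / (1 + t²), at least 4 on [0, 1]; the crude bound 1 already keeps `∣S¹∣` away
-- from zero.
1≤monomialIntegrand-0-0 : ∀ t → 0ℚ ℚ.≤ t → t ℚ.≤ 1ℚ → 1ℚ ℚ.≤ monomialIntegrand 0 0 t
1≤monomialIntegrand-0-0 t 0≤t t≤1 = begin
  1ℚ                            ≡⟨ v-inverse t ⟨
  (1ℚ ℚ.+ t ℚ.* t) ℚ.* v t      ≤⟨ ℚₚ.*-monoʳ-≤-nonNeg (v t) {{nonNegative (0≤v t)}} 1+t²≤8 ⟩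
  8ℚ ℚ.* v t                    ≡⟨ solve 1 (λ v → con 8ℚ :* v := con 4ℚ :* (con 2ℚ :* v)) refl (v t) ⟩
  monomialIntegrand 0 0 t       ∎
  where
  open ℚₚ.≤-Reasoning
  8ℚ = + 8 ℚ./ 1
  4ℚ = + 4 ℚ./ 1
  1+t²≤8 : 1ℚ ℚ.+ t ℚ.* t ℚ.≤ 8ℚ
  1+t²≤8 = ℚₚ.≤-trans (ℚₚ.+-monoʳ-≤ 1ℚ (*-mono-≤ {t} {1ℚ} {t} {1ℚ} 0≤t 0≤1 t≤1 t≤1)) (ℚ.*≤* (ℤ.+≤+ (ℕ.s≤s (ℕ.s≤s ℕ.z≤n))))

1≤∣S¹∣ : ∀ n → 1ℚ ℚ.≤ seq ∣S¹∣ n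
1≤∣S¹∣ n = ℚₚ.≤-trans (1≤g⇒h≤riemannSum (monomialIntegrand 0 0) 1≤monomialIntegrand-0-0 n 0ℚ 1ℚ ℚₚ.≤-refl 0≤1 ℚₚ.≤-refl)
  (ℚₚ.≤-reflexive (solve 1 (λ x → x := con 1ℚ :* x :+ con 0ℚ) refl (riemannSum (monomialIntegrand 0 0) 0ℚ 1ℚ n)))

∣S¹∣*p≈0⇒p≡0 : ∀ p → ∣S¹∣ * fromℚ p ≈ 0ℝ → p ≡ 0ℚ
∣S¹∣*p≈0⇒p≡0 p (mk≈ small) = ∣p∣≤ε⇒p≡0 p λ ε 0<ε → let N , close = small ε 0<ε in begin
  ∣ p ∣                              ≡⟨ ℚₚ.*-identityˡ ∣ p ∣ ⟨
  1ℚ ℚ.* ∣ p ∣                       ≤⟨ ℚₚ.*-monoʳ-≤-nonNeg ∣ p ∣ {{ℚₚ.∣-∣-nonNeg p}} (1≤∣S¹∣ N) ⟩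
  seq ∣S¹∣ N ℚ.* ∣ p ∣               ≡⟨ cong (ℚ._* ∣ p ∣) (ℚₚ.0≤p⇒∣p∣≡p (ℚₚ.≤-trans 0≤1 (1≤∣S¹∣ N))) ⟨
  ∣ seq ∣S¹∣ N ∣ ℚ.* ∣ p ∣           ≡⟨ ℚₚ.∣p*q∣≡∣p∣*∣q∣ (seq ∣S¹∣ N) p ⟨
  ∣ seq ∣S¹∣ N ℚ.* p ∣               ≡⟨ cong ∣_∣ (ℚₚ.+-identityʳ (seq ∣S¹∣ N ℚ.* p)) ⟨
  ∣ seq ∣S¹∣ N ℚ.* p - 0ℚ ∣          ≤⟨ close N ℕₚ.≤-refl ⟩
  ε                                  ∎
  where open ℚₚ.≤-Reasoning

-- The test polynomial and its integral.

15ℚ : ℚ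
15ℚ = + 15 ℚ./ 1

-- The real part of (x + iy)⁶.
sextic : Polynomial
sextic = (1ℝ , 6 , 0) ∷ (fromℚ (ℚ.- 15ℚ) , 4 , 2) ∷ (fromℚ 15ℚ , 2 , 4) ∷ (fromℚ (ℚ.- 1ℚ) , 0 , 6) ∷ []

sextic-degree : DegreeAtMost 6 sextic
sextic-degree = ℕₚ.≤-refl ∷ ℕₚ.≤-refl ∷ ℕₚ.≤-refl ∷ ℕₚ.≤-refl ∷ []

-- A quarter turn multiplies (x + iy)⁶ by i⁶ = -1, so the four quadrants cancel pointwise.
∮sextic≈0 : ∮ sextic ≈ 0ℝ
∮sextic≈0 = ≗⇒≈ λ n → begin
  1ℚ ℚ.* R 6 0 n ℚ.+ (ℚ.- 15ℚ ℚ.* R 4 2 n ℚ.+ (15ℚ ℚ.* R 2 4 n ℚ.+ (ℚ.- 1ℚ ℚ.* R 0 6 n ℚ.+ 0ℚ)))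
    ≡⟨ cong₂ ℚ._+_ (scale 1ℚ 6 0 n) (cong₂ ℚ._+_ (scale (ℚ.- 15ℚ) 4 2 n) (cong₂ ℚ._+_ (scale 15ℚ 2 4 n)
         (trans (ℚₚ.+-identityʳ _) (scale (ℚ.- 1ℚ) 0 6 n)))) ⟩
  ∫ f₁ n ℚ.+ (∫ f₂ n ℚ.+ (∫ f₃ n ℚ.+ ∫ f₄ n))
    ≡⟨ cong (λ z → ∫ f₁ n ℚ.+ (∫ f₂ n ℚ.+ z)) (riemannSum-+ f₃ f₄ n 0ℚ 1ℚ) ⟨
  ∫ f₁ n ℚ.+ (∫ f₂ n ℚ.+ ∫ (λ t → f₃ t ℚ.+ f₄ t) n)
    ≡⟨ cong (λ z → ∫ f₁ n ℚ.+ z) (riemannSum-+ f₂ (λ t → f₃ t ℚ.+ f₄ t) n 0ℚ 1ℚ) ⟨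
  ∫ f₁ n ℚ.+ ∫ (λ t → f₂ t ℚ.+ (f₃ t ℚ.+ f₄ t)) n
    ≡⟨ riemannSum-+ f₁ (λ t → f₂ t ℚ.+ (f₃ t ℚ.+ f₄ t)) n 0ℚ 1ℚ ⟨
  ∫ (λ t → f₁ t ℚ.+ (f₂ t ℚ.+ (f₃ t ℚ.+ f₄ t))) n
    ≡⟨ riemannSum-cong (λ t → cancel (γx t) (γy t) (speed t)) n 0ℚ 1ℚ ⟩
  ∫ (λ _ → 0ℚ) n
    ≡⟨ riemannSum-0 n 0ℚ 1ℚ ⟩
  0ℚ ∎
  where
  open ≡-Reasoning
  ∫ : (ℚ → ℚ) → ℕ → ℚ
  ∫ g = riemannSum g 0ℚ 1ℚ
  R : ℕ → ℕ → ℕ → ℚ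
  R i j = ∫ (monomialIntegrand i j)
  f₁ f₂ f₃ f₄ : ℚ → ℚ
  f₁ t = 1ℚ ℚ.* monomialIntegrand 6 0 t
  f₂ t = ℚ.- 15ℚ ℚ.* monomialIntegrand 4 2 t
  f₃ t = 15ℚ ℚ.* monomialIntegrand 2 4 t
  f₄ t = ℚ.- 1ℚ ℚ.* monomialIntegrand 0 6 t
  scale : ∀ c i j n → c ℚ.* R i j n ≡ ∫ (λ t → c ℚ.* monomialIntegrand i j t) n
  scale c i j n = sym (riemannSum-* c (monomialIntegrand i j) n 0ℚ 1ℚ)
  quarterTurns : ℕ → ℕ → ℚ → ℚ → ℚ → ℚ
  quarterTurns i j x y s = (x ^ℚ i ℚ.* y ^ℚ j ℚ.+ (ℚ.- y) ^ℚ i ℚ.* x ^ℚ j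
    ℚ.+ (ℚ.- x) ^ℚ i ℚ.* (ℚ.- y) ^ℚ j ℚ.+ y ^ℚ i ℚ.* (ℚ.- x) ^ℚ j) ℚ.* s
  cancel : ∀ x y s → 1ℚ ℚ.* quarterTurns 6 0 x y s ℚ.+ (ℚ.- 15ℚ ℚ.* quarterTurns 4 2 x y s
    ℚ.+ (15ℚ ℚ.* quarterTurns 2 4 x y s ℚ.+ ℚ.- 1ℚ ℚ.* quarterTurns 0 6 x y s)) ≡ 0ℚ
  cancel = solve 3 (λ x y s → con 1ℚ :* turns 6 0 x y s :+ (con (ℚ.- 15ℚ) :* turns 4 2 x y s
    :+ (con 15ℚ :* turns 2 4 x y s :+ con (ℚ.- 1ℚ) :* turns 0 6 x y s)) := con 0ℚ) refl
    where
    -- Powers unfold here exactly as `_^ℚ_` does, so that the solver's expression evaluates to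
    -- `quarterTurns` by definition.
    infixr 9 _^′_
    _^′_ : ∀ {k} → +-*-Solver.Polynomial k → ℕ → +-*-Solver.Polynomial k
    p ^′ zero  = con 1ℚ
    p ^′ suc i = p :* p ^′ i
    turns : ∀ {k} → ℕ → ℕ → (x y s : +-*-Solver.Polynomial k) → +-*-Solver.Polynomial k
    turns i j x y s = (x ^′ i :* y ^′ j :+ (:- y) ^′ i :* x ^′ j :+ (:- x) ^′ i :* (:- y) ^′ j :+ y ^′ i :* (:- x) ^′ j) :* s

-- The Dickson polynomial over ℚ and ℝ.

2ℝ : ℝ
2ℝ = fromℚ 2ℚ

dicksonℚ : ℚ → ℚ → ℚ
dicksonℚ t m = u ℚ.* u ℚ.- 2ℚ ℚ.* (m ℚ.* (m ℚ.* m))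
  where u = t ℚ.* (t ℚ.* t) ℚ.- 3ℚ ℚ.* (m ℚ.* t)

ι-minus : ∀ i j → ι (i ℤ.- j) ≡ ι i ℚ.- ι j
ι-minus i j = trans (ι-+ i (ℤ.- j)) (cong (λ z → ι i ℚ.+ z) (ι-neg j))

ι-dickson₆ : ∀ t n → ι (dickson₆ t n) ≡ dicksonℚ (ι t) (ι n)
ι-dickson₆ t n = trans (ι-minus (u ℤ.* u) (+ 2 ℤ.* (n ℤ.* (n ℤ.* n))))
  (cong₂ ℚ._-_ (trans (ι-* u u) (cong₂ ℚ._*_ ι-u ι-u)) (trans (ι-* (+ 2) (n ℤ.* (n ℤ.* n))) (cong (2ℚ ℚ.*_) (ι-cube n))))
  where
  u = t ℤ.* (t ℤ.* t) ℤ.- + 3 ℤ.* (n ℤ.* t)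
  ι-cube : ∀ i → ι (i ℤ.* (i ℤ.* i)) ≡ ι i ℚ.* (ι i ℚ.* ι i)
  ι-cube i = trans (ι-* i (i ℤ.* i)) (cong (ι i ℚ.*_) (ι-* i i))
  ι-u : ι u ≡ ι t ℚ.* (ι t ℚ.* ι t) ℚ.- 3ℚ ℚ.* (ι n ℚ.* ι t)
  ι-u = trans (ι-minus (t ℤ.* (t ℤ.* t)) (+ 3 ℤ.* (n ℤ.* t))) (cong₂ ℚ._-_ (ι-cube t) (trans (ι-* (+ 3) (n ℤ.* t)) (cong (3ℚ ℚ.*_) (ι-* n t))))

-- Differences are written with negative coefficients, so that `+-cong` and `*-cong` alone give the
-- congruence.
dicksonℝ : ℝ → ℝ → ℝ
dicksonℝ t m = u * u + fromℚ (ℚ.- 2ℚ) * (m * (m * m))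
  where u = t * (t * t) + fromℚ (ℚ.- 3ℚ) * (m * t)

dicksonℝ-cong : ∀ {t t′ m m′} → t ≈ t′ → m ≈ m′ → dicksonℝ t m ≈ dicksonℝ t′ m′
dicksonℝ-cong t≈ m≈ = +-cong (*-cong u≈ u≈) (*-cong ≈-refl (*-cong m≈ (*-cong m≈ m≈)))
  where u≈ = +-cong (*-cong t≈ (*-cong t≈ t≈)) (*-cong ≈-refl (*-cong m≈ t≈))

dicksonℝ-fromℤ : ∀ t n → dicksonℝ (fromℤ t) (fromℤ n) ≈ fromℤ (dickson₆ t n)
dicksonℝ-fromℤ t n = ≗⇒≈ λ _ → trans
  (solve 2 (λ t m → let u  = t :* (t :* t) :+ con (ℚ.- 3ℚ) :* (m :* t)
                        u′ = t :* (t :* t) :- con 3ℚ :* (m :* t) in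
              u :* u :+ con (ℚ.- 2ℚ) :* (m :* (m :* m)) := u′ :* u′ :- con 2ℚ :* (m :* (m :* m))) refl (ι t) (ι n))
  (sym (ι-dickson₆ t n))

-- Homogeneity, and 2 Re z⁶ in terms of z + z̄ and z z̄.
2r⁶sextic≈dickson : ∀ r p → let (x , y) = r · p in
  2ℝ * r ^ 6 * evaluate sextic p ≈ dicksonℝ (x + x) ⟨ r · p , r · p ⟩
2r⁶sextic≈dickson r (x , y) = ≗⇒≈ λ n → solve 3 (λ r x y →
  let X = r :* x
      Y = r :* y
      t = X :+ X
      m = X :* X :+ Y :* Y
      u = t :* (t :* t) :+ con (ℚ.- 3ℚ) :* (m :* t)
  in con 2ℚ :* pow r 6 :* (con 1ℚ :* (pow x 6 :* con 1ℚ) :+ (con (ℚ.- 15ℚ) :* (pow x 4 :* pow y 2)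
       :+ (con 15ℚ :* (pow x 2 :* pow y 4) :+ (con (ℚ.- 1ℚ) :* (con 1ℚ :* pow y 6) :+ con 0ℚ))))
  := u :* u :+ con (ℚ.- 2ℚ) :* (m :* (m :* m))) refl (seq r n) (seq x n) (seq y n)
  where
  pow : ∀ {k} → +-*-Solver.Polynomial k → ℕ → +-*-Solver.Polynomial k
  pow p zero    = con 1ℚ
  pow p (suc i) = p :* pow p i

-- The Eisenstein integers as points of the plane.

lattice : 𝔼 → ℝ²
lattice (a +ω b) = fromℤ a · (1ℝ , 0ℝ) ⊕ fromℤ b · (fromℚ ½ , fromℚ ½ * √3)

≈²-sym : ∀ {p q} → p ≈² q → q ≈² p
≈²-sym (x≈ , y≈) = ≈-sym x≈ , ≈-sym y≈

≈²-trans : ∀ {p q s} → p ≈² q → q ≈² s → p ≈² s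
≈²-trans (x≈ , y≈) (x≈′ , y≈′) = ≈-trans x≈ x≈′ , ≈-trans y≈ y≈′

·-congʳ : ∀ r {p q} → p ≈² q → r · p ≈² r · q
·-congʳ r (x≈ , y≈) = *-cong ≈-refl x≈ , *-cong ≈-refl y≈

⟨⟩-cong : ∀ {p q} → p ≈² q → ⟨ p , p ⟩ ≈ ⟨ q , q ⟩
⟨⟩-cong (x≈ , y≈) = +-cong (*-cong x≈ x≈) (*-cong y≈ y≈)

⟨lattice,lattice⟩≈norm : ∀ z → ⟨ lattice z , lattice z ⟩ ≈ fromℤ (norm z)
⟨lattice,lattice⟩≈norm z@(a +ω b) = begin
  ⟨ lattice z , lattice z ⟩
    ≈⟨ ≗⇒≈ (λ n → solve 3 (λ a b s →
         (a :* con 1ℚ :+ b :* con ½) :* (a :* con 1ℚ :+ b :* con ½)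
           :+ (a :* con 0ℚ :+ b :* (con ½ :* s)) :* (a :* con 0ℚ :+ b :* (con ½ :* s))
         := a :* a :+ a :* b :+ con ½ :* con ½ :* (b :* b) :+ con ½ :* con ½ :* (b :* b) :* (s :* s)) refl (ι a) (ι b) (√3-seq n)) ⟩
  fromℚ (ι a ℚ.* ι a ℚ.+ ι a ℚ.* ι b ℚ.+ ½ ℚ.* ½ ℚ.* (ι b ℚ.* ι b)) + fromℚ (½ ℚ.* ½ ℚ.* (ι b ℚ.* ι b)) * (√3 * √3)
    ≈⟨ +-cong ≈-refl (*-cong ≈-refl √3²≈3) ⟩
  fromℚ (ι a ℚ.* ι a ℚ.+ ι a ℚ.* ι b ℚ.+ ½ ℚ.* ½ ℚ.* (ι b ℚ.* ι b)) + fromℚ (½ ℚ.* ½ ℚ.* (ι b ℚ.* ι b)) * fromℚ 3ℚ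
    ≈⟨ ≗⇒≈ (λ _ → trans (solve 2 (λ a b → a :* a :+ a :* b :+ con ½ :* con ½ :* (b :* b) :+ con ½ :* con ½ :* (b :* b) :* con 3ℚ
         := a :* a :+ a :* b :+ b :* b) refl (ι a) (ι b)) ι-norm) ⟩
  fromℤ (norm z) ∎
  where
  open SetoidReasoning ℝ-setoid
  ι-norm : ι a ℚ.* ι a ℚ.+ ι a ℚ.* ι b ℚ.+ ι b ℚ.* ι b ≡ ι (norm z)
  ι-norm = sym (trans (ι-+ (a ℤ.* a ℤ.+ a ℤ.* b) (b ℤ.* b)) (cong₂ ℚ._+_
    (trans (ι-+ (a ℤ.* a) (a ℤ.* b)) (cong₂ ℚ._+_ (ι-* a a) (ι-* a b))) (ι-* b b)))

lattice-trace : ∀ z → let (x , _) = lattice z in x + x ≈ fromℤ (trace z)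
lattice-trace (a +ω b) = ≗⇒≈ λ _ → trans
  (solve 2 (λ a b → (a :* con 1ℚ :+ b :* con ½) :+ (a :* con 1ℚ :+ b :* con ½) := a :+ (a :+ b)) refl (ι a) (ι b))
  (sym (trans (ι-+ a (a ℤ.+ b)) (cong (ι a ℚ.+_) (ι-+ a b))))

-- The second coordinate b √3 / 2 becomes the rational 3b / 2 when multiplied by √3, which
-- determines b; the first, a + b / 2, then determines a.
lattice-injective : ∀ {z w} → lattice z ≈² lattice w → z ≡ w
lattice-injective {a +ω b} {c +ω d} (x≈ , y≈) = cong₂ _+ω_ (ι-injective ιa≡ιc) (ι-injective ιb≡ιd)
  where
  y*√3≈ : ∀ a b → (fromℤ a * 0ℝ + fromℤ b * (fromℚ ½ * √3)) * √3 ≈ fromℚ (½ ℚ.* ι b ℚ.* 3ℚ)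
  y*√3≈ a b = begin
    (fromℤ a * 0ℝ + fromℤ b * (fromℚ ½ * √3)) * √3
      ≈⟨ ≗⇒≈ (λ n → solve 3 (λ a b s → (a :* con 0ℚ :+ b :* (con ½ :* s)) :* s := con ½ :* b :* (s :* s)) refl (ι a) (ι b) (√3-seq n)) ⟩
    fromℚ (½ ℚ.* ι b) * (√3 * √3)
      ≈⟨ *-cong ≈-refl √3²≈3 ⟩
    fromℚ (½ ℚ.* ι b) * fromℚ 3ℚ
      ≈⟨ ≗⇒≈ (λ _ → refl) ⟩
    fromℚ (½ ℚ.* ι b ℚ.* 3ℚ) ∎
    where open SetoidReasoning ℝ-setoid
  ⅔ = + 2 ℚ./ 3
  ⅔-cancel : ∀ p → ⅔ ℚ.* (½ ℚ.* p ℚ.* 3ℚ) ≡ p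
  ⅔-cancel = solve 1 (λ p → con ⅔ :* (con ½ :* p :* con 3ℚ) := p) refl
  ιb≡ιd : ι b ≡ ι d
  ιb≡ιd = trans (sym (⅔-cancel (ι b))) (trans (cong (⅔ ℚ.*_)
    (fromℚ-injective (≈-trans (≈-sym (y*√3≈ a b)) (≈-trans (*-cong y≈ ≈-refl) (y*√3≈ c d))))) (⅔-cancel (ι d)))
  x≡ : ι a ℚ.* 1ℚ ℚ.+ ι b ℚ.* ½ ≡ ι c ℚ.* 1ℚ ℚ.+ ι d ℚ.* ½
  x≡ = fromℚ-injective (≈-trans (≗⇒≈ λ _ → refl) (≈-trans x≈ (≗⇒≈ λ _ → refl)))
  recover : ∀ p q → p ≡ (p ℚ.* 1ℚ ℚ.+ q ℚ.* ½) ℚ.- q ℚ.* ½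
  recover = solve 2 (λ p q → p := (p :* con 1ℚ :+ q :* con ½) :- q :* con ½) refl
  ιa≡ιc : ι a ≡ ι c
  ιa≡ιc = trans (recover (ι a) (ι b)) (trans (cong₂ (λ s t → s ℚ.- t ℚ.* ½) x≡ ιb≡ιd) (sym (recover (ι c) (ι d))))

-- From a design to a vanishing integer sum.

module _ {m : ℝ} (0<m : 0ℝ < m) (z₀ : 𝔼) (m≈norm : m ≈ fromℤ (norm z₀)) (d : IsSphericalDesign 6 (shell m)) where
  open IsSphericalDesign d renaming (radius to r)
  open IsUnitDesign design
  open _Enumerates_ finite

  z₀≢0 : z₀ ≢ 0ℤ +ω 0ℤ
  z₀≢0 z₀≡0 = x<y⇒x≉y 0<m (≈-sym (≈-trans m≈norm (≗⇒≈ λ _ → cong (ι ∘ norm) z₀≡0)))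

  norm≡⇒shell : ∀ z → ∥ z ∥ ≡ ∥ z₀ ∥ → shell m (lattice z)
  norm≡⇒shell z@(a +ω b) eq = (a , b , ≈-refl , ≈-refl) , ≈-trans (⟨lattice,lattice⟩≈norm z)
    (≈-trans (≗⇒≈ λ _ → cong ι (trans (norm≡+∥∥ z) (trans (cong +_ eq) (sym (norm≡+∥∥ z₀))))) (≈-sym m≈norm))

  r²≈norm : r * r ≈ fromℤ (norm z₀)
  r²≈norm = ≈-trans (≈-sym (onSphere (lattice z₀) (norm≡⇒shell z₀ refl))) (⟨lattice,lattice⟩≈norm z₀)

  ιnorm≢0 : ι (norm z₀) ≢ 0ℚ
  ιnorm≢0 eq = z₀≢0 (∥x∥≡0⇒x≡0 z₀ (cong ℤ.∣_∣ (ι-injective {norm z₀} {0ℤ} eq)))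

  c : ℚ
  c = (ℚ.1/ ι (norm z₀)) {{ℚ.≢-nonZero ιnorm≢0}}

  -- Since r² = norm z₀, the inverse of r is r / norm z₀.
  r⁻¹ : ℝ
  r⁻¹ = r * fromℚ c

  r*r⁻¹≈1 : r * r⁻¹ ≈ 1ℝ
  r*r⁻¹≈1 = begin
    r * (r * fromℚ c)              ≈⟨ ≗⇒≈ (λ n → sym (ℚₚ.*-assoc (seq r n) (seq r n) c)) ⟩
    r * r * fromℚ c                ≈⟨ *-cong r²≈norm ≈-refl ⟩
    fromℤ (norm z₀) * fromℚ c      ≈⟨ ≗⇒≈ (λ _ → ℚₚ.*-inverseʳ (ι (norm z₀)) {{ℚ.≢-nonZero ιnorm≢0}}) ⟩
    1ℝ                             ∎
    where open SetoidReasoning ℝ-setoid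

  r·r⁻¹·p≈p : ∀ p → r · (r⁻¹ · p) ≈² p
  r·r⁻¹·p≈p (x , y) = scale x , scale y
    where
    scale : ∀ x → r * (r⁻¹ * x) ≈ x
    scale x = begin
      r * (r⁻¹ * x)   ≈⟨ ≗⇒≈ (λ n → sym (ℚₚ.*-assoc (seq r n) (seq r⁻¹ n) (seq x n))) ⟩
      r * r⁻¹ * x     ≈⟨ *-cong r*r⁻¹≈1 ≈-refl ⟩
      1ℝ * x          ≈⟨ ≗⇒≈ (λ n → ℚₚ.*-identityˡ (seq x n)) ⟩
      x               ∎
      where open SetoidReasoning ℝ-setoid

  ·-cancel : ∀ {p q} → r · p ≈² r · q → p ≈² q
  ·-cancel {p} {q} eq = ≈²-trans (≈²-sym (r⁻¹·r·p≈p p)) (≈²-trans (·-congʳ r⁻¹ eq) (r⁻¹·r·p≈p q))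
    where
    swap : ∀ x → r⁻¹ * (r * x) ≈ r * (r⁻¹ * x)
    swap x = ≗⇒≈ λ n → solve 3 (λ s r x → s :* (r :* x) := r :* (s :* x)) refl (seq r⁻¹ n) (seq r n) (seq x n)
    r⁻¹·r·p≈p : ∀ p → r⁻¹ · (r · p) ≈² p
    r⁻¹·r·p≈p p@(x , y) = ≈²-trans (swap x , swap y) (r·r⁻¹·p≈p p)

  shell-resp : ∀ {p q} → p ≈² q → shell m q → shell m p
  shell-resp p≈q ((a , b , q≈) , ⟨q,q⟩≈m) = (a , b , ≈²-trans p≈q q≈) , ≈-trans (⟨⟩-cong p≈q) ⟨q,q⟩≈m

  _Represents_ : ℝ² → 𝔼 → Set
  p Represents z = r · p ≈² lattice z × ∥ z ∥ ≡ ∥ z₀ ∥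

  represent : ∀ {ps} → All (r ⁻¹· shell m) ps → ∃ (Pointwise _Represents_ ps)
  represent []                        = [] , []
  represent {p ∷ _} (((a , b , rp≈) , ⟨rp,rp⟩≈m) ∷ rest) =
    let zs , reps = represent rest in (a +ω b) ∷ zs , (rp≈ , cong ℤ.∣_∣ (ι-injective {norm (a +ω b)} {norm z₀} (fromℚ-injective norm≈))) ∷ reps
    where
    norm≈ : fromℤ (norm (a +ω b)) ≈ fromℤ (norm z₀)
    norm≈ = ≈-trans (≈-sym (≈-trans (⟨⟩-cong {r · p} {lattice (a +ω b)} rp≈) (⟨lattice,lattice⟩≈norm (a +ω b)))) (≈-trans ⟨rp,rp⟩≈m m≈norm)

  -- The factor r⁶ undoes the scaling to the unit circle, and the factor 2 turns real parts into
  -- integer traces.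
  2r⁶Σsextic≈ : ∀ {ps zs} → Pointwise _Represents_ ps zs →
    2ℝ * r ^ 6 * sum (map (evaluate sextic) ps) ≈ fromℤ (dicksonSum zs)
  2r⁶Σsextic≈ [] = ≗⇒≈ λ n → ℚₚ.*-zeroʳ (seq (2ℝ * r ^ 6) n)
  2r⁶Σsextic≈ {p ∷ ps} {z ∷ zs} ((rp≈ , _) ∷ reps) = begin
    2ℝ * r ^ 6 * (evaluate sextic p + sum (map (evaluate sextic) ps))
      ≈⟨ ≗⇒≈ (λ n → ℚₚ.*-distribˡ-+ (seq (2ℝ * r ^ 6) n) (seq (evaluate sextic p) n) (seq (sum (map (evaluate sextic) ps)) n)) ⟩
    2ℝ * r ^ 6 * evaluate sextic p + 2ℝ * r ^ 6 * sum (map (evaluate sextic) ps)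
      ≈⟨ +-cong (≈-trans (2r⁶sextic≈dickson r p) (≈-trans (dicksonℝ-cong t≈ n≈) (dicksonℝ-fromℤ (trace z) (norm z)))) (2r⁶Σsextic≈ reps) ⟩
    fromℤ (dickson₆ (trace z) (norm z)) + fromℤ (dicksonSum zs)
      ≈⟨ ≗⇒≈ (λ _ → sym (ι-+ (dickson₆ (trace z) (norm z)) (dicksonSum zs))) ⟩
    fromℤ (dicksonSum (z ∷ zs)) ∎
    where
    open SetoidReasoning ℝ-setoid
    t≈ = ≈-trans (+-cong (proj₁ rp≈) (proj₁ rp≈)) (lattice-trace z)
    n≈ = ≈-trans (⟨⟩-cong {r · p} {lattice z} rp≈) (⟨lattice,lattice⟩≈norm z)

  unique : ∀ {ps zs} → Pointwise _Represents_ ps zs → AllPairs (λ p q → ¬ p ≈² q) ps → Unique zs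
  unique []                   []              = []
  unique {p ∷ _} {z ∷ _} ((rp≈ , _) ∷ reps) (p∉ ∷ distinct) = fresh reps p∉ ∷ unique reps distinct
    where
    fresh : ∀ {ps zs} → Pointwise _Represents_ ps zs → All (λ q → ¬ p ≈² q) ps → All (z ≢_) zs
    fresh []                    []         = []
    fresh {q ∷ _} ((rq≈ , _) ∷ reps) (p≉q ∷ p∉) =
      (λ { refl → p≉q (·-cancel (≈²-trans {r · p} rp≈ (≈²-sym {r · q} rq≈))) }) ∷ fresh reps p∉

  norms : ∀ {ps zs z} → Pointwise _Represents_ ps zs → z ∈ zs → ∥ z ∥ ≡ ∥ z₀ ∥
  norms ((_ , eq) ∷ _) (here refl) = eq
  norms (_ ∷ reps)     (there z∈)  = norms reps z∈

  member : ∀ {ps zs} z → Pointwise _Represents_ ps zs → Any (r⁻¹ · lattice z ≈²_) ps → z ∈ zs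
  member {p ∷ _} {w ∷ _} z ((rp≈ , _) ∷ _) (here ≈p) = here (lattice-injective {z} {w}
    (≈²-trans (≈²-sym (r·r⁻¹·p≈p (lattice z))) (≈²-trans (·-congʳ r {r⁻¹ · lattice z} {p} ≈p) rp≈)))
  member z (_ ∷ reps) (there any) = there (member z reps any)

  -- The design's list of real points becomes a list of integers to which `dicksonSum≢0` applies.
  -- For completeness, z is scaled down by `r⁻¹` and looked up among the design's points.
  latticeShell : Shell ∥ z₀ ∥
  latticeShell = let zs , reps = represent sound in record
    { points   = zs
    ; unique   = unique reps distinct
    ; sound    = norms reps
    ; complete = λ {z} eq → member z reps (complete (r⁻¹ · lattice z)
        (shell-resp (r·r⁻¹·p≈p (lattice z)) (norm≡⇒shell z eq))) }

  -- The averaging identity for `sextic`, multiplied by 2 r⁶: its right side vanishes with the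
  -- integral, and `∣S¹∣` cancels on the left.
  dicksonSum≡0 : dicksonSum (Shell.points latticeShell) ≡ 0ℤ
  dicksonSum≡0 = ι-injective (∣S¹∣*p≈0⇒p≡0 _ (begin
    ∣S¹∣ * fromℤ (dicksonSum (Shell.points latticeShell))
      ≈⟨ *-cong ≈-refl (≈-sym (2r⁶Σsextic≈ (proj₂ (represent sound)))) ⟩
    ∣S¹∣ * (C * S)
      ≈⟨ ≗⇒≈ (λ n → solve 3 (λ a b c → a :* (b :* c) := b :* (a :* c)) refl (seq ∣S¹∣ n) (seq C n) (seq S n)) ⟩
    C * (∣S¹∣ * S)
      ≈⟨ *-cong ≈-refl (≈-trans (average sextic sextic-degree) (*-cong ≈-refl ∮sextic≈0)) ⟩
    C * (fromℤ (+ length points) * 0ℝ)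
      ≈⟨ ≗⇒≈ (λ n → solve 2 (λ a b → a :* (b :* con 0ℚ) := con 0ℚ) refl (seq C n) (ι (+ length points))) ⟩
    0ℝ ∎))
    where
    open SetoidReasoning ℝ-setoid
    C = 2ℝ * r ^ 6
    S = sum (map (evaluate sextic) points)

theorem1p2 : (m : ℝ) → 0ℝ < m → ∃ (shell m) → ¬ IsSphericalDesign 6 (shell m)
theorem1p2 m 0<m (p , (a , b , p≈) , ⟨p,p⟩≈m) design =
  dicksonSum≢0 z₀ (z₀≢0 0<m z₀ m≈norm design) (latticeShell 0<m z₀ m≈norm design) (dicksonSum≡0 0<m z₀ m≈norm design)
  where
  z₀ = a +ω b
  m≈norm : m ≈ fromℤ (norm z₀)
  m≈norm = ≈-trans (≈-sym ⟨p,p⟩≈m) (≈-trans (⟨⟩-cong {p} {lattice z₀} p≈) (⟨lattice,lattice⟩≈norm z₀))
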